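{- Let $k$ be a positive integer, and let $n$ and $r$ be integers with $n<3k$ and $r\ge 2(k-1)$ such that there exists at least one $r$-regular graph on $n$ vertices with chromatic number $k$. Then $d(n,r,\chi=k)=k-1$.
   Context: All graphs are finite and simple. For a graph $G$, $\chi(G)$ denotes its chromatic number. A set $S$ of vertices of $G$ together with an assignment of colors to the vertices of $S$ is a defining set of the vertex coloring of $G$ if this partial coloring extends in exactly one way to a proper coloring of all vertices of $G$ with $\chi(G)$ colors. The defining number $d(G,\chi)$ is the minimum cardinality of a defining set of $G$. For integers $n,r,k$, $d(n,r,\chi=k)$ denotes the minimum of $d(G,\chi)$ over all $r$-regular graphs $G$ on $n$ vertices with $\chi(G)=k$. -}

module Defs where

open import Data.Nat using (ℕ; zero; suc; _+_; _*_; _∸_; _≤_; _<_)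
open import Data.Bool using (Bool; true; false)
open import Data.Fin using (Fin)
open import Data.List using (List; map; allFin)
open import Data.Nat.ListAction using (sum)
open import Data.Maybe using (Maybe; just; nothing; is-just)
open import Data.Product using (Σ; _×_; _,_; ∃; ∃-syntax)
open import Relation.Binary.PropositionalEquality using (_≡_; _≢_)

record Graph (n : ℕ) : Set where
  field
    adj     : Fin n → Fin n → Bool
    adj-sym : ∀ i j → adj i j ≡ adj j i
    irrefl  : ∀ i → adj i i ≡ false
open Graph public

toℕ𝔹 : Bool → ℕ
toℕ𝔹 true  = 1
toℕ𝔹 false = 0

degree : ∀ {n} → Graph n → Fin n → ℕ
degree {n} G i = sum (map (λ j → toℕ𝔹 (adj G i j)) (allFin n))

Regular : ∀ {n} → ℕ → Graph n → Set
Regular r G = ∀ i → degree G i ≡ r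

Coloring : ℕ → ℕ → Set
Coloring n c = Fin n → Fin c

IsProper : ∀ {n c} → Graph n → Coloring n c → Set
IsProper G f = ∀ i j → adj G i j ≡ true → f i ≢ f j

Colorable : ∀ {n} → Graph n → ℕ → Set
Colorable {n} G c = Σ (Coloring n c) (IsProper G)

ChromaticNumber : ∀ {n} → Graph n → ℕ → Set
ChromaticNumber G k = Colorable G k × (∀ m → m < k → Colorable G m → Data.Empty.⊥)
  where import Data.Empty

-- A partial coloring: a set S of vertices (those mapped to 'just')
-- together with a color in Fin c for each of them.
PartialColoring : ℕ → ℕ → Set
PartialColoring n c = Fin n → Maybe (Fin c)

size : ∀ {n c} → PartialColoring n c → ℕ
size {n} p = sum (map (λ i → toℕ𝔹 (is-just (p i))) (allFin n))

Extends : ∀ {n c} → Coloring n c → PartialColoring n c → Set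
Extends f p = ∀ i x → p i ≡ just x → f i ≡ x

IsDefiningSet : ∀ {n c} → Graph n → PartialColoring n c → Set
IsDefiningSet {n} {c} G p =
  Σ (Coloring n c) λ f → IsProper G f × Extends f p ×
    (∀ (g : Coloring n c) → IsProper G g → Extends g p → ∀ i → g i ≡ f i)

DefiningNumber : ∀ {n} → Graph n → (k : ℕ) → ℕ → Set
DefiningNumber {n} G k d =
  (Σ (PartialColoring n k) λ p → IsDefiningSet G p × size p ≡ d) ×
  (∀ (p : PartialColoring n k) → IsDefiningSet G p → d ≤ size p)

InClass : (n r k : ℕ) → Graph n → Set
InClass n r k G = Regular r G × ChromaticNumber G k

MinDefiningNumber : (n r k d : ℕ) → Set
MinDefiningNumber n r k d =
  (Σ (Graph n) λ G → InClass n r k G × DefiningNumber G k d) ×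
  (∀ (G : Graph n) → InClass n r k G → ∀ e → DefiningNumber G k e → d ≤ e)

{-# OPTIONS --safe #-}

-- Two colours missing from a defining set could be interchanged in its extension, so a defining
-- set of a k-chromatic graph shows at least k - 1 colours.
--
-- For the converse a graph is constructed.  Let d = n - r = p + 2, b = n - 2k and a = 3k - n, so
-- that p ≤ b and 1 ≤ a; counting shows that b (p - 1) is even, that b = 0 if p = 0, and that
-- a ≥ 2 if p = 1.  Take b classes {u, w, w′} and a classes {x, y}, and describe the complement H
-- of the graph, which must be (d - 1)-regular.  Besides the pairs inside the classes, H has the
-- edges uᵢwⱼ, wᵢwⱼ′, wᵢ′uⱼ for all i < j joined in a (p - 1)-regular circulant graph Z on the
-- b triples.  A pair {x, y} is then spliced into a matching of H: edges w′z of the matching are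
-- replaced by xw′ and yz.  If a ≥ 2p, the pairs take care of their degrees by themselves, by
-- means of a circulant bipartite graph between the x and the y; otherwise they are divided into
-- two kinds joined completely, and the remaining degree is obtained by splicing along the
-- permutations i ↦ i + t that make up Z.  The u and x form a clique of size k in the graph,
-- and one vertex from all but one of the classes forces the rest of the colouring, in the order:
-- remaining class, x, w, y, w′.

module Submission where

open import Defs
open import Data.Bool using (Bool; true; false; not; _∧_; _∨_; if_then_else_)
import Data.Bool.Properties as Bool
open import Data.Empty using (⊥; ⊥-elim)
open import Data.Fin using (Fin; zero; suc; toℕ; fromℕ<; inject≤; opposite; punchOut; _↑ˡ_; _↑ʳ_; combine; remQuot; splitAt; join)
import Data.Fin as Fin
open import Data.Fin.Induction using (<-wellFounded; >-wellFounded)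
open import Data.Fin.Patterns using (0F; 1F; 2F)
open import Data.Fin.Permutation using (permutation)
open import Data.Fin.Permutation.Components using (transpose; transpose-inverse)
import Data.Fin.Properties as Fin
open import Data.List using (List; []; _∷_; length; map; mapMaybe; allFin; tabulate)
open import Data.List.Membership.Propositional using (_∈_; _∉_)
open import Data.List.Membership.Propositional.Properties using (∈-allFin)
open import Data.List.Membership.Setoid.Properties using (index-injective)
open import Data.List.Properties using (map-tabulate)
open import Data.List.Relation.Unary.Any using (here; there; index)
open import Data.Maybe using (just; nothing; is-just)
open import Data.Maybe.Properties using (just-injective)
open import Data.Nat
import Data.Nat.ListAction as List
open import Data.Nat.Properties
open import Data.Nat.Tactic.RingSolver using (solve-∀)
open import Data.Product using (Σ; ∃; _×_; _,_; proj₁; proj₂)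
open import Data.Sum using (_⊎_; inj₁; inj₂; [_,_]′)
import Data.Sum.Properties as Sum
open import Function using (_∘_; id)
open import Induction.WellFounded using (Acc; acc)
open import Relation.Binary using (tri<; tri≈; tri>)
open import Relation.Binary.PropositionalEquality
open import Relation.Nullary
open import Relation.Nullary.Decidable using (decidable-stable; dec-true; dec-false)
open import Algebra.Properties.CommutativeMonoid.Sum +-0-commutativeMonoid
open import Algebra.Properties.CommutativeSemigroup +-commutativeSemigroup using (interchange)

-- Finite sums

⟦_⟧ : Bool → ℕ
⟦_⟧ = toℕ𝔹

-- `degree` and `size` are list sums; all counting below uses sums over `Fin`, which can be
-- exchanged and permuted.
list-sum≡∑ : ∀ {n} (f : Fin n → ℕ) → List.sum (map f (allFin n)) ≡ ∑[ i < n ] f i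
list-sum≡∑ {n} f = trans (cong List.sum (map-tabulate id f)) (go f)
  where
  go : ∀ {n} (f : Fin n → ℕ) → List.sum (tabulate f) ≡ ∑[ i < n ] f i
  go {zero}  f = refl
  go {suc n} f = cong (f zero +_) (go (f ∘ suc))

∑-const : ∀ n c → ∑[ i < n ] c ≡ n * c
∑-const zero    c = refl
∑-const (suc n) c = cong (c +_) (∑-const n c)

∑-one : ∀ n → ∑[ i < n ] 1 ≡ n
∑-one n = trans (∑-const n 1) (*-identityʳ n)

∑-mono-≤ : ∀ {n} {f g : Fin n → ℕ} → (∀ i → f i ≤ g i) → ∑[ i < n ] f i ≤ ∑[ i < n ] g i
∑-mono-≤ {zero}  f≤g = z≤n
∑-mono-≤ {suc n} f≤g = +-mono-≤ (f≤g zero) (∑-mono-≤ (f≤g ∘ suc))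

∑-↑ : ∀ m {n} (f : Fin (m + n) → ℕ) →
      ∑[ i < m + n ] f i ≡ ∑[ i < m ] f (i ↑ˡ n) + ∑[ i < n ] f (m ↑ʳ i)
∑-↑ zero    f = refl
∑-↑ (suc m) f = trans (cong (f zero +_) (∑-↑ m (f ∘ suc))) (sym (+-assoc (f zero) _ _))

∑-combine : ∀ m {n} (f : Fin (m * n) → ℕ) →
            ∑[ i < m * n ] f i ≡ ∑[ i < m ] ∑[ j < n ] f (combine i j)
∑-combine zero        f = refl
∑-combine (suc m) {n} f = trans (∑-↑ n f) (cong (∑[ j < n ] f (j ↑ˡ (m * n)) +_) (∑-combine m (f ∘ (n ↑ʳ_))))

∑-⟦≟⟧ : ∀ {n} (i : Fin n) → ∑[ j < n ] ⟦ does (i Fin.≟ j) ⟧ ≡ 1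
∑-⟦≟⟧ {suc n} zero    = cong suc (sum-replicate-zero n)
∑-⟦≟⟧ {suc n} (suc i) = ∑-⟦≟⟧ i

⟦⟧≤1 : ∀ x → ⟦ x ⟧ ≤ 1
⟦⟧≤1 true  = ≤-refl
⟦⟧≤1 false = z≤n

⟦not⟧+⟦⟧ : ∀ x → ⟦ not x ⟧ + ⟦ x ⟧ ≡ 1
⟦not⟧+⟦⟧ true  = refl
⟦not⟧+⟦⟧ false = refl

any : ∀ {n} → (Fin n → Bool) → Bool
any {zero}  f = false
any {suc n} f = f zero ∨ any (f ∘ suc)

any-witness : ∀ {n} (f : Fin n → Bool) → any f ≡ true → ∃ λ i → f i ≡ true
any-witness {suc n} f eq with f zero in f0
... | true  = zero , f0
... | false = let i , fi = any-witness (f ∘ suc) eq in suc i , fi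

any-false : ∀ {n} (f : Fin n → Bool) → (∀ i → f i ≡ false) → any f ≡ false
any-false {zero}  f h = refl
any-false {suc n} f h rewrite h zero = any-false (f ∘ suc) (h ∘ suc)

true≢false : ∀ {x} → x ≡ true → x ≡ false → ⊥
true≢false refl ()

-- Uniqueness leaves at most one term equal to 1. This converts each `any` in the adjacency of the
-- construction into a sum of entries of `R`.
∑-any : ∀ {n} (f : Fin n → Bool) → (∀ i j → f i ≡ true → f j ≡ true → i ≡ j) →
        ∑[ i < n ] ⟦ f i ⟧ ≡ ⟦ any f ⟧
∑-any {zero}  f uniq = refl
∑-any {suc n} f uniq with f zero in f0
... | true  = cong suc (trans (sum-cong-≗ (λ i → cong ⟦_⟧ (rest i))) (sum-replicate-zero n))
  where
  rest : ∀ i → f (suc i) ≡ false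
  rest i with f (suc i) in fi
  ... | false = refl
  ... | true  with () ← uniq zero (suc i) f0 fi
... | false = ∑-any (f ∘ suc) (λ i j p q → Fin.suc-injective (uniq (suc i) (suc j) p q))

∑-any-∧ : ∀ {n} (P Q : Fin n → Bool) → (∀ i j → Q i ≡ true → Q j ≡ true → i ≡ j) →
          ∑[ j < n ] ⟦ P j ∧ Q j ⟧ ≡ ⟦ any (λ j → P j ∧ Q j) ⟧
∑-any-∧ P Q uniq = ∑-any (λ j → P j ∧ Q j) (λ i j Pi Pj → uniq i j (right (P i) Pi) (right (P j) Pj))
  where
  right : ∀ z {z′} → z ∧ z′ ≡ true → z′ ≡ true
  right true eq = eq

-- Counts what the pairs contribute to the degree of a vertex of pair `e`: the own pair counts
-- twice, and since `h e` is false the disjunction swallows no term of `h`.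
∑-≟∨ : ∀ {a} e (h : Fin a → Bool) → h e ≡ false →
       ∑[ e′ < a ] (⟦ does (e Fin.≟ e′) ⟧ + ⟦ does (e Fin.≟ e′) ∨ h e′ ⟧) ≡ 2 + ∑[ e′ < a ] ⟦ h e′ ⟧
∑-≟∨ {a} e h he≡false = begin
  ∑[ e′ < a ] (⟦ does (e Fin.≟ e′) ⟧ + ⟦ does (e Fin.≟ e′) ∨ h e′ ⟧)
    ≡⟨ sum-cong-≗ pointwise ⟩
  ∑[ e′ < a ] (⟦ does (e Fin.≟ e′) ⟧ + (⟦ does (e Fin.≟ e′) ⟧ + ⟦ h e′ ⟧))
    ≡⟨ ∑-distrib-+ (λ e′ → ⟦ does (e Fin.≟ e′) ⟧) (λ e′ → ⟦ does (e Fin.≟ e′) ⟧ + ⟦ h e′ ⟧) ⟩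
  ∑[ e′ < a ] ⟦ does (e Fin.≟ e′) ⟧ + ∑[ e′ < a ] (⟦ does (e Fin.≟ e′) ⟧ + ⟦ h e′ ⟧)
    ≡⟨ cong₂ _+_ (∑-⟦≟⟧ e) (trans (∑-distrib-+ (λ e′ → ⟦ does (e Fin.≟ e′) ⟧) (λ e′ → ⟦ h e′ ⟧)) (cong (_+ ∑[ e′ < a ] ⟦ h e′ ⟧) (∑-⟦≟⟧ e))) ⟩
  2 + ∑[ e′ < a ] ⟦ h e′ ⟧ ∎
  where
  open ≡-Reasoning
  pointwise : ∀ e′ → ⟦ does (e Fin.≟ e′) ⟧ + ⟦ does (e Fin.≟ e′) ∨ h e′ ⟧ ≡ ⟦ does (e Fin.≟ e′) ⟧ + (⟦ does (e Fin.≟ e′) ⟧ + ⟦ h e′ ⟧)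
  pointwise e′ with e Fin.≟ e′
  ... | no  _    = refl
  ... | yes refl rewrite he≡false = refl

⟦⟧≡0⇒false : ∀ {z} → ⟦ z ⟧ ≡ 0 → z ≡ false
⟦⟧≡0⇒false {false} _ = refl

∑≡0⇒≡0 : ∀ {n} (f : Fin n → ℕ) → ∑[ i < n ] f i ≡ 0 → ∀ i → f i ≡ 0
∑≡0⇒≡0 f eq zero    = m+n≡0⇒m≡0 (f zero) eq
∑≡0⇒≡0 f eq (suc i) = ∑≡0⇒≡0 (f ∘ suc) (m+n≡0⇒n≡0 (f zero) eq) i

Even : ℕ → Set
Even m = ∃ λ h → m ≡ h + h

-- Removing the first row and column of a symmetric matrix removes every other entry twice.
∑∑-even : ∀ {n} (M : Fin n → Fin n → ℕ) → (∀ i j → M i j ≡ M j i) → (∀ i → M i i ≡ 0) →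
          Even (∑[ i < n ] ∑[ j < n ] M i j)
∑∑-even {zero}  M M-sym M-diag = 0 , refl
∑∑-even {suc n} M M-sym M-diag with ∑∑-even (λ i j → M (suc i) (suc j)) (λ i j → M-sym (suc i) (suc j)) (M-diag ∘ suc)
... | h , eq = row + h , (begin
    M zero zero + row + ∑[ i < n ] (M (suc i) zero + ∑[ j < n ] M (suc i) (suc j))
      ≡⟨ cong₂ (λ x y → x + row + y) (M-diag zero) (∑-distrib-+ (λ i → M (suc i) zero) (λ i → ∑[ j < n ] M (suc i) (suc j))) ⟩
    row + (∑[ i < n ] M (suc i) zero + ∑[ i < n ] ∑[ j < n ] M (suc i) (suc j))
      ≡⟨ cong₂ (λ x y → row + (x + y)) (sum-cong-≗ (λ i → M-sym (suc i) zero)) eq ⟩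
    row + (row + (h + h))
      ≡⟨ sym (+-assoc row row (h + h)) ⟩
    row + row + (h + h)
      ≡⟨ interchange row row h h ⟩
    row + h + (row + h) ∎)
  where
  open ≡-Reasoning
  row = ∑[ j < n ] M zero (suc j)

-- Bounds valid for every graph in the class

-- If every colour occurred, its position would map the `k` colours injectively to fewer than `k`
-- places.
missing-element : ∀ {k} (L : List (Fin k)) → length L < k → ∃ λ c → c ∉ L
missing-element L short with Fin.any? (λ c → ¬? (c ∈? L))
  where open import Data.List.Membership.DecPropositional Fin._≟_ using (_∈?_)
... | yes missing = missing
... | no  none    = let i , j , i<j , eq = Fin.pigeonhole short (index ∘ present)
                    in ⊥-elim (Fin.<⇒≢ i<j (index-injective (setoid _) (present i) (present j) eq))
  where
  open import Data.List.Membership.DecPropositional Fin._≟_ using (_∈?_)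
  present : ∀ c → c ∈ L
  present c = decidable-stable (c ∈? L) (λ c∉L → none (c , c∉L))

colours : ∀ {n c} → PartialColoring n c → List (Fin c)
colours {n} p = mapMaybe p (allFin n)

size≡length-colours : ∀ {n c} (p : PartialColoring n c) → size p ≡ length (colours p)
size≡length-colours {n} p = go (allFin n)
  where
  go : ∀ is → List.sum (map (λ i → toℕ𝔹 (is-just (p i))) is) ≡ length (mapMaybe p is)
  go []       = refl
  go (i ∷ is) with p i
  ... | just _  = cong suc (go is)
  ... | nothing = go is

∈-colours : ∀ {n c} (p : PartialColoring n c) {i x} → p i ≡ just x → x ∈ colours p
∈-colours p {i} {x} pi≡x = go (∈-allFin i)
  where
  go : ∀ {is} → i ∈ is → x ∈ mapMaybe p is
  go (here refl) rewrite pi≡x = here refl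
  go (there {j} i∈is) with p j
  ... | just _  = there (go i∈is)
  ... | nothing = go i∈is

unused⇒colorable : ∀ {n k} {G : Graph n} (f : Coloring n (suc k)) → IsProper G f →
                   (c : Fin (suc k)) → (∀ i → f i ≢ c) → Colorable G k
unused⇒colorable f proper c unused =
  (λ i → punchOut (unused i ∘ sym)) ,
  (λ i j ij eq → proper i j ij (Fin.punchOut-injective (unused i ∘ sym) (unused j ∘ sym) eq))

transpose-left : ∀ {n} (i j : Fin n) → transpose i j i ≡ j
transpose-left i j rewrite dec-true (i Fin.≟ i) refl = refl

transpose-other : ∀ {n} {i j k : Fin n} → k ≢ i → k ≢ j → transpose i j k ≡ k
transpose-other {i = i} {j} {k} k≢i k≢j
  rewrite dec-false (k Fin.≟ i) k≢i | dec-false (k Fin.≟ j) k≢j = refl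

-- If fewer than `k` of `suc k` colours are shown, two distinct colours `c` and `d` are missing.
-- Interchanging them in `f` gives another extension, so by uniqueness `f` uses neither, and `k`
-- colours suffice, against minimality.
defining-set-size : ∀ {n k} {G : Graph n} → ChromaticNumber G k →
                    (p : PartialColoring n k) → IsDefiningSet G p → k ∸ 1 ≤ size p
defining-set-size {k = zero}      _ p _ = z≤n
defining-set-size {n} {suc k} {G} (_ , minimal) p (f , proper , extends , unique)
  with k ≤? size p
... | yes k≤size = k≤size
... | no  k≰size = ⊥-elim (minimal k ≤-refl (unused⇒colorable {G = G} f proper c f-avoids-c))
  where
  size<k : length (colours p) < k
  size<k = subst (_< k) (size≡length-colours p) (≰⇒> k≰size)
  c,c∉ = missing-element (colours p) (m<n⇒m<1+n size<k)
  c    = proj₁ c,c∉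
  -- Putting `c` on the list makes `d` differ from `c`; the bound on the size leaves room for it.
  d,d∉ = missing-element (c ∷ colours p) (s<s size<k)
  d    = proj₁ d,d∉
  τ    = transpose c d
  τ-injective : ∀ {x y} → τ x ≡ τ y → x ≡ y
  τ-injective {x} {y} eq = trans (sym (transpose-inverse d c)) (trans (cong (transpose d c) eq) (transpose-inverse d c))
  τ∘f-extends : Extends (τ ∘ f) p
  τ∘f-extends i x pi≡x = trans (cong τ (extends i x pi≡x)) (transpose-other
    (λ x≡c → proj₂ c,c∉ (subst (_∈ colours p) x≡c (∈-colours p pi≡x)))
    (λ x≡d → proj₂ d,d∉ (there (subst (_∈ colours p) x≡d (∈-colours p pi≡x)))))
  f-avoids-c : ∀ i → f i ≢ c
  f-avoids-c i fi≡c = proj₂ d,d∉ (here (begin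
    d         ≡⟨ sym (transpose-left c d) ⟩
    τ c       ≡⟨ cong τ (sym fi≡c) ⟩
    τ (f i)   ≡⟨ unique (τ ∘ f) (λ i j ij → proper i j ij ∘ τ-injective) τ∘f-extends i ⟩
    f i       ≡⟨ fi≡c ⟩
    c         ∎))
    where open ≡-Reasoning

degree≡∑ : ∀ {n} (G : Graph n) i → degree G i ≡ ∑[ j < n ] ⟦ adj G i j ⟧
degree≡∑ G i = list-sum≡∑ (λ j → ⟦ adj G i j ⟧)

handshake : ∀ {n r} {G : Graph n} → Regular r G → Even (n * r)
handshake {n} {r} {G} regular = subst Even total
  (∑∑-even (λ i j → ⟦ adj G i j ⟧) (λ i j → cong ⟦_⟧ (adj-sym G i j)) (λ i → cong ⟦_⟧ (irrefl G i)))
  where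
  total : ∑[ i < n ] ∑[ j < n ] ⟦ adj G i j ⟧ ≡ n * r
  total = trans (sum-cong-≗ (λ i → trans (sym (degree≡∑ G i)) (regular i))) (∑-const n r)

module _ {n k r d} {G : Graph n} (regular : Regular r G) (r+d≡n : r + d ≡ n)
         (f : Coloring n k) (proper : IsProper G f) where

  classSize : Fin k → ℕ
  classSize c = ∑[ i < n ] ⟦ does (f i Fin.≟ c) ⟧

  ∑-classSize : ∑[ c < k ] classSize c ≡ n
  ∑-classSize = begin
    ∑[ c < k ] ∑[ i < n ] ⟦ does (f i Fin.≟ c) ⟧ ≡⟨ ∑-comm (λ c i → ⟦ does (f i Fin.≟ c) ⟧) ⟩
    ∑[ i < n ] ∑[ c < k ] ⟦ does (f i Fin.≟ c) ⟧ ≡⟨ sum-cong-≗ (λ i → ∑-⟦≟⟧ (f i)) ⟩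
    ∑[ i < n ] 1                                 ≡⟨ ∑-one n ⟩
    n                                            ∎
    where open ≡-Reasoning

  ∑-adj : ∀ v → ∑[ i < n ] ⟦ adj G v i ⟧ ≡ r
  ∑-adj v = trans (sym (degree≡∑ G v)) (regular v)

  -- A vertex has exactly `n - r = d` non-neighbours, itself included, and `h` is at most their
  -- indicator.
  non-neighbours-≤ : ∀ v (h : Fin n → ℕ) → (∀ i → h i + ⟦ adj G v i ⟧ ≤ 1) → ∑[ i < n ] h i ≤ d
  non-neighbours-≤ v h h+adj≤1 = +-cancelʳ-≤ r _ _ (begin
    ∑[ i < n ] h i + r                          ≡⟨ cong (∑[ i < n ] h i +_) (sym (∑-adj v)) ⟩
    ∑[ i < n ] h i + ∑[ i < n ] ⟦ adj G v i ⟧   ≡⟨ sym (∑-distrib-+ h (λ i → ⟦ adj G v i ⟧)) ⟩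
    ∑[ i < n ] (h i + ⟦ adj G v i ⟧)            ≤⟨ ∑-mono-≤ h+adj≤1 ⟩
    ∑[ i < n ] 1                                ≡⟨ ∑-one n ⟩
    n                                           ≡⟨ trans (sym r+d≡n) (+-comm r d) ⟩
    d + r                                       ∎)
    where open ≤-Reasoning

  same-class⇒≤1 : ∀ v i → ⟦ does (f i Fin.≟ f v) ⟧ + ⟦ adj G v i ⟧ ≤ 1
  same-class⇒≤1 v i with f i Fin.≟ f v
  ... | no  _ = ⟦⟧≤1 (adj G v i)
  ... | yes fi≡fv with adj G v i in vi
  ...   | true  = ⊥-elim (proper v i vi (sym fi≡fv))
  ...   | false = ≤-refl

  empty⇒classSize≡0 : ∀ c → ¬ (∃ λ v → f v ≡ c) → classSize c ≡ 0
  empty⇒classSize≡0 c empty = trans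
    (sum-cong-≗ (λ i → cong ⟦_⟧ (dec-false (f i Fin.≟ c) (λ fi≡c → empty (i , fi≡c)))))
    (sum-replicate-zero n)

  classSize-≤ : ∀ c → classSize c ≤ d
  classSize-≤ c with Fin.any? (λ v → f v Fin.≟ c)
  ... | yes (v , refl) = non-neighbours-≤ v _ (same-class⇒≤1 v)
  ... | no  empty      = subst (_≤ d) (sym (empty⇒classSize≡0 c empty)) z≤n

  order-≤ : n ≤ k * d
  order-≤ = begin
    n                       ≡⟨ sym ∑-classSize ⟩
    ∑[ c < k ] classSize c  ≤⟨ ∑-mono-≤ classSize-≤ ⟩
    ∑[ c < k ] d            ≡⟨ ∑-const k d ⟩
    k * d                   ∎
    where open ≤-Reasoning

  order-+-≤ : (h : Fin k → ℕ) → (∀ c → classSize c + h c ≤ d) → n + ∑[ c < k ] h c ≤ k * d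
  order-+-≤ h size+h≤d = begin
    n + ∑[ c < k ] h c                       ≡⟨ cong (_+ ∑[ c < k ] h c) (sym ∑-classSize) ⟩
    ∑[ c < k ] classSize c + ∑[ c < k ] h c  ≡⟨ sym (∑-distrib-+ classSize h) ⟩
    ∑[ c < k ] (classSize c + h c)           ≤⟨ ∑-mono-≤ size+h≤d ⟩
    ∑[ c < k ] d                             ≡⟨ ∑-const k d ⟩
    k * d                                    ∎
    where open ≤-Reasoning

  -- A vertex of a class with fewer than d members has a non-neighbour outside the class;
  -- the class of that non-neighbour has fewer than d members, too.
  not-one-deficient-class : 2 ≤ d → suc n ≢ k * d
  not-one-deficient-class 2≤d n+1≡kd = <-irrefl refl (begin-strict
    suc n                                                            <⟨ ≤-refl ⟩
    2 + n                                                            ≡⟨ +-comm 2 n ⟩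
    n + 2                                                            ≡⟨ cong (n +_) (sym ∑h≡2) ⟩
    n + ∑[ c < k ] h c                                               ≤⟨ order-+-≤ h size+h≤d ⟩
    k * d                                                            ≡⟨ sym n+1≡kd ⟩
    suc n                                                            ∎)
    where
    open ≤-Reasoning
    some-deficient : ∃ λ c → ¬ d ≤ classSize c
    some-deficient = Fin.¬∀⟶∃¬ k _ (λ c → d ≤? classSize c) (λ full → <-irrefl refl (begin-strict
      n                       <⟨ ≤-refl ⟩
      suc n                   ≡⟨ n+1≡kd ⟩
      k * d                   ≡⟨ sym (∑-const k d) ⟩
      ∑[ c < k ] d            ≤⟨ ∑-mono-≤ full ⟩
      ∑[ c < k ] classSize c  ≡⟨ ∑-classSize ⟩
      n                       ∎))
    c₁ = proj₁ some-deficient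
    c₁-deficient : classSize c₁ < d
    c₁-deficient = ≰⇒> (proj₂ some-deficient)

    δ : Fin k → Fin k → ℕ
    δ c c′ = ⟦ does (c Fin.≟ c′) ⟧
    ∑δδ : ∀ c c′ → ∑[ x < k ] (δ c x + δ c′ x) ≡ 2
    ∑δδ c c′ = trans (∑-distrib-+ (δ c) (δ c′)) (cong₂ _+_ (∑-⟦≟⟧ c) (∑-⟦≟⟧ c′))

    -- An empty class would lack `d ≥ 2` members, whereas only one is lacking in total.
    nonempty : ∃ λ v → f v ≡ c₁
    nonempty with Fin.any? (λ v → f v Fin.≟ c₁)
    ... | yes v    = v
    ... | no empty = ⊥-elim (<-irrefl refl (begin-strict
      suc n                                <⟨ ≤-refl ⟩
      2 + n                                ≡⟨ +-comm 2 n ⟩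
      n + 2                                ≡⟨ cong (n +_) (sym (∑δδ c₁ c₁)) ⟩
      n + ∑[ x < k ] (δ c₁ x + δ c₁ x)     ≤⟨ order-+-≤ (λ x → δ c₁ x + δ c₁ x) bound ⟩
      k * d                                ≡⟨ sym n+1≡kd ⟩
      suc n                                ∎))
      where
      bound : ∀ x → classSize x + (δ c₁ x + δ c₁ x) ≤ d
      bound x with c₁ Fin.≟ x
      ... | yes refl = subst (λ s → s + 2 ≤ d) (sym (empty⇒classSize≡0 c₁ empty)) 2≤d
      ... | no _     = subst (_≤ d) (sym (+-identityʳ _)) (classSize-≤ x)

    v = proj₁ nonempty
    -- Otherwise the class of `v` and the neighbours of `v` would cover all vertices, giving
    -- `n ≤ classSize c₁ + r < d + r = n`.
    outside : ∃ λ z → adj G v z ≡ false × f z ≢ f v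
    outside with Fin.any? (λ z → (adj G v z Bool.≟ false) ×-dec ¬? (f z Fin.≟ f v))
    ... | yes z = z
    ... | no none = ⊥-elim (<-irrefl refl (begin-strict
      n                                                                        ≡⟨ sym (∑-one n) ⟩
      ∑[ i < n ] 1                                                             ≤⟨ ∑-mono-≤ 1≤ ⟩
      ∑[ i < n ] (⟦ does (f i Fin.≟ f v) ⟧ + ⟦ adj G v i ⟧)                    ≡⟨ ∑-distrib-+ (λ i → ⟦ does (f i Fin.≟ f v) ⟧) (λ i → ⟦ adj G v i ⟧) ⟩
      classSize (f v) + ∑[ i < n ] ⟦ adj G v i ⟧                               ≡⟨ cong₂ (λ c s → classSize c + s) (proj₂ nonempty) (∑-adj v) ⟩
      classSize c₁ + r                                                         <⟨ +-monoˡ-< r c₁-deficient ⟩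
      d + r                                                                    ≡⟨ trans (+-comm d r) r+d≡n ⟩
      n                                                                        ∎))
      where
      1≤ : ∀ i → 1 ≤ ⟦ does (f i Fin.≟ f v) ⟧ + ⟦ adj G v i ⟧
      1≤ i with f i Fin.≟ f v
      ... | yes _ = s≤s z≤n
      ... | no fi≢fv with adj G v i in vi
      ...   | true  = ≤-refl
      ...   | false = ⊥-elim (none (i , vi , fi≢fv))

    z = proj₁ outside
    -- The members of the class of `z`, and `v` besides, are all non-neighbours of `z`.
    c₂-deficient : classSize (f z) + 1 ≤ d
    c₂-deficient = subst (_≤ d)
      (trans (∑-distrib-+ (λ i → ⟦ does (f i Fin.≟ f z) ⟧) (λ i → ⟦ does (v Fin.≟ i) ⟧)) (cong (classSize (f z) +_) (∑-⟦≟⟧ v)))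
      (non-neighbours-≤ z (λ i → ⟦ does (f i Fin.≟ f z) ⟧ + ⟦ does (v Fin.≟ i) ⟧) bound)
      where
      bound : ∀ i → ⟦ does (f i Fin.≟ f z) ⟧ + ⟦ does (v Fin.≟ i) ⟧ + ⟦ adj G z i ⟧ ≤ 1
      bound i with v Fin.≟ i
      ... | no  _ = subst (_≤ 1) (cong (_+ ⟦ adj G z i ⟧) (sym (+-identityʳ _))) (same-class⇒≤1 z i)
      ... | yes refl rewrite dec-false (f v Fin.≟ f z) (proj₂ (proj₂ outside) ∘ sym)
                           | adj-sym G z v | proj₁ (proj₂ outside) = ≤-refl

    h : Fin k → ℕ
    h c = δ c₁ c + δ (f z) c
    ∑h≡2 : ∑[ c < k ] h c ≡ 2
    ∑h≡2 = ∑δδ c₁ (f z)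
    size+h≤d : ∀ c → classSize c + h c ≤ d
    size+h≤d c with c₁ Fin.≟ c | f z Fin.≟ c
    ... | yes refl | yes fz≡c₁ = ⊥-elim (proj₂ (proj₂ outside) (trans fz≡c₁ (sym (proj₂ nonempty))))
    ... | yes refl | no  _     = subst (_≤ d) (+-comm 1 _) c₁-deficient
    ... | no  _    | yes refl  = c₂-deficient
    ... | no  _    | no  _     = subst (_≤ d) (sym (+-identityʳ _)) (classSize-≤ c)

-- The construction

-- The triples are indexed by Fin b and the pairs by Fin a.  R e m i says that the pair e is
-- spliced into the edge of H joining w′ₘ to triple i, and Y e e′ that x of e and y of e′ are
-- joined in H.  The coloured vertex of the pair e is x if side e is true, and y otherwise.
record Blueprint (b a p : ℕ) : Set where
  field
    Z            : Fin b → Fin b → Bool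
    Z-sym        : ∀ i j → Z i j ≡ Z j i
    Z-irrefl     : ∀ i → Z i i ≡ false
    -- Avoiding the subtraction `p - 1` makes `p = 0` possible only without triples.
    Z-degree     : ∀ i → suc (∑[ j < b ] ⟦ Z i j ⟧) ≡ p
    R            : Fin a → Fin b → Fin b → Bool
    R⊆Z          : ∀ e m i → R e m i ≡ true → Z m i ≡ true
    R-functional : ∀ e m i i′ → R e m i ≡ true → R e m i′ ≡ true → i ≡ i′
    R-injective  : ∀ e m m′ i → R e m i ≡ true → R e m′ i ≡ true → m ≡ m′
    R-disjoint   : ∀ e e′ m i → R e m i ≡ true → R e′ m i ≡ true → e ≡ e′
    Y            : Fin a → Fin a → Bool
    Y-irrefl     : ∀ e → Y e e ≡ false
    -- Each splice gives one edge to `x` and one to `y`. The edge joining them adds one more, for a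
    -- total of `p + 1 = d - 1`.
    x-degree     : ∀ e → ∑[ m < b ] ∑[ i < b ] ⟦ R e m i ⟧ + ∑[ e′ < a ] ⟦ Y e e′ ⟧ ≡ p
    y-degree     : ∀ e → ∑[ m < b ] ∑[ i < b ] ⟦ R e m i ⟧ + ∑[ e′ < a ] ⟦ Y e′ e ⟧ ≡ p
    side         : Fin a → Bool
    -- Within one side `Y` has no cycles, so the uncoloured vertices of that side can be forced one
    -- after another.
    Y-triangular : ∀ e e′ → side e ≡ side e′ → Y e e′ ≡ true → toℕ e < toℕ e′

module Construction {b a p : ℕ} (B : Blueprint b a p) where

  open Blueprint B

  data Vertex : Set where
    u w w′ : Fin b → Vertex
    x y    : Fin a → Vertex

  Class : Set
  Class = Fin b ⊎ Fin a

  _≟ᶜ_ : (c c′ : Class) → Dec (c ≡ c′)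
  _≟ᶜ_ = Sum.≡-dec Fin._≟_ Fin._≟_

  class : Vertex → Class
  class (u i)  = inj₁ i
  class (w i)  = inj₁ i
  class (w′ i) = inj₁ i
  class (x e)  = inj₂ e
  class (y e)  = inj₂ e

  _<ᶠ_ : Fin b → Fin b → Bool
  i <ᶠ j = does (i Fin.<? j)

  -- The edges of Z that have not been spliced.
  K : Fin b → Fin b → Bool
  K m i = Z m i ∧ not (any λ e → R e m i)

  -- For `i < j` joined in `Z`, the three edges form a perfect matching of the two triples. The edge
  -- from `w′ m` towards triple `i` ends at `u i` if `m < i` and at `w i` if `i < m`; once spliced,
  -- `x e` takes over the end `w′ m` and `y e` the other end.
  link : Vertex → Vertex → Bool
  link (u i)  (w j)  = (i <ᶠ j) ∧ Z i j
  link (w j)  (u i)  = (i <ᶠ j) ∧ Z i j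
  link (w i)  (w′ m) = (i <ᶠ m) ∧ K m i
  link (w′ m) (w i)  = (i <ᶠ m) ∧ K m i
  link (u i)  (w′ m) = (m <ᶠ i) ∧ K m i
  link (w′ m) (u i)  = (m <ᶠ i) ∧ K m i
  link (u i)  (y e)  = any λ m → (m <ᶠ i) ∧ R e m i
  link (y e)  (u i)  = any λ m → (m <ᶠ i) ∧ R e m i
  link (w i)  (y e)  = any λ m → (i <ᶠ m) ∧ R e m i
  link (y e)  (w i)  = any λ m → (i <ᶠ m) ∧ R e m i
  link (w′ m) (x e)  = any λ i → R e m i
  link (x e)  (w′ m) = any λ i → R e m i
  link (x e)  (y e′) = Y e e′
  link (y e′) (x e)  = Y e e′
  link _      _      = false

  link-sym : ∀ v v′ → link v v′ ≡ link v′ v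
  link-sym (u _)  (u _)  = refl
  link-sym (u _)  (w _)  = refl
  link-sym (u _)  (w′ _) = refl
  link-sym (u _)  (x _)  = refl
  link-sym (u _)  (y _)  = refl
  link-sym (w _)  (u _)  = refl
  link-sym (w _)  (w _)  = refl
  link-sym (w _)  (w′ _) = refl
  link-sym (w _)  (x _)  = refl
  link-sym (w _)  (y _)  = refl
  link-sym (w′ _) (u _)  = refl
  link-sym (w′ _) (w _)  = refl
  link-sym (w′ _) (w′ _) = refl
  link-sym (w′ _) (x _)  = refl
  link-sym (w′ _) (y _)  = refl
  link-sym (x _)  (u _)  = refl
  link-sym (x _)  (w _)  = refl
  link-sym (x _)  (w′ _) = refl
  link-sym (x _)  (x _)  = refl
  link-sym (x _)  (y _)  = refl
  link-sym (y _)  (u _)  = refl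
  link-sym (y _)  (w _)  = refl
  link-sym (y _)  (w′ _) = refl
  link-sym (y _)  (x _)  = refl
  link-sym (y _)  (y _)  = refl

  -- Adjacency in H, with loops; the graph itself is its negation.
  near : Vertex → Vertex → Bool
  near v v′ = does (class v ≟ᶜ class v′) ∨ link v v′

  ≟ᶜ-sym : ∀ c c′ → does (c ≟ᶜ c′) ≡ does (c′ ≟ᶜ c)
  ≟ᶜ-sym c c′ with c ≟ᶜ c′
  ... | yes c≡c′ = sym (dec-true (c′ ≟ᶜ c) (sym c≡c′))
  ... | no  c≢c′ = sym (dec-false (c′ ≟ᶜ c) (c≢c′ ∘ sym))

  near-sym : ∀ v v′ → near v v′ ≡ near v′ v
  near-sym v v′ = cong₂ _∨_ (≟ᶜ-sym (class v) (class v′)) (link-sym v v′)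

  same-class⇒near : ∀ v v′ → class v ≡ class v′ → near v v′ ≡ true
  same-class⇒near v v′ eq = cong (_∨ link v v′) (dec-true (class v ≟ᶜ class v′) eq)

  ¬near : ∀ {v v′} → class v ≢ class v′ → link v v′ ≡ false → near v v′ ≡ false
  ¬near {v} {v′} c≢ l≡ = cong₂ _∨_ (dec-false (class v ≟ᶜ class v′) c≢) l≡

  -- Numbering of the vertices

  vertices : ℕ
  vertices = b * 3 + a * 2

  decode₃ : Fin b × Fin 3 → Vertex
  decode₃ (i , 0F) = u i
  decode₃ (i , 1F) = w i
  decode₃ (i , 2F) = w′ i

  decode₂ : Fin a × Fin 2 → Vertex
  decode₂ (e , 0F) = x e
  decode₂ (e , 1F) = y e

  decode⊎ : Fin (b * 3) ⊎ Fin (a * 2) → Vertex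
  decode⊎ = [ decode₃ ∘ remQuot 3 , decode₂ ∘ remQuot 2 ]′

  decode : Fin vertices → Vertex
  decode = decode⊎ ∘ splitAt (b * 3)

  encode⊎ : Vertex → Fin (b * 3) ⊎ Fin (a * 2)
  encode⊎ (u i)  = inj₁ (combine i 0F)
  encode⊎ (w i)  = inj₁ (combine i 1F)
  encode⊎ (w′ i) = inj₁ (combine i 2F)
  encode⊎ (x e)  = inj₂ (combine e 0F)
  encode⊎ (y e)  = inj₂ (combine e 1F)

  encode : Vertex → Fin vertices
  encode = join (b * 3) (a * 2) ∘ encode⊎

  decode∘encode : ∀ v → decode (encode v) ≡ v
  decode∘encode v = trans (cong decode⊎ (Fin.splitAt-join (b * 3) (a * 2) (encode⊎ v))) (go v)
    where
    go : ∀ v → decode⊎ (encode⊎ v) ≡ v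
    go (u i)  = cong decode₃ (Fin.remQuot-combine i 0F)
    go (w i)  = cong decode₃ (Fin.remQuot-combine i 1F)
    go (w′ i) = cong decode₃ (Fin.remQuot-combine i 2F)
    go (x e)  = cong decode₂ (Fin.remQuot-combine e 0F)
    go (y e)  = cong decode₂ (Fin.remQuot-combine e 1F)

  encode∘decode : ∀ i → encode (decode i) ≡ i
  encode∘decode i = trans (cong (join (b * 3) (a * 2)) (go (splitAt (b * 3) i))) (Fin.join-splitAt (b * 3) (a * 2) i)
    where
    go₃ : ∀ q → encode⊎ (decode₃ q) ≡ inj₁ (combine (proj₁ q) (proj₂ q))
    go₃ (i , 0F) = refl
    go₃ (i , 1F) = refl
    go₃ (i , 2F) = refl
    go₂ : ∀ q → encode⊎ (decode₂ q) ≡ inj₂ (combine (proj₁ q) (proj₂ q))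
    go₂ (i , 0F) = refl
    go₂ (i , 1F) = refl
    go : ∀ s → encode⊎ (decode⊎ s) ≡ s
    go (inj₁ j) = trans (go₃ (remQuot 3 j)) (cong inj₁ (Fin.combine-remQuot {b} 3 j))
    go (inj₂ j) = trans (go₂ (remQuot 2 j)) (cong inj₂ (Fin.combine-remQuot {a} 2 j))

  ∑-vertices : (F : Vertex → ℕ) → ∑[ i < vertices ] F (decode i) ≡
    ∑[ i < b ] (F (u i) + F (w i) + F (w′ i)) + ∑[ e < a ] (F (x e) + F (y e))
  ∑-vertices F = trans (∑-↑ (b * 3) (F ∘ decode)) (cong₂ _+_
    (trans (∑-combine b (λ j → F (decode (j ↑ˡ (a * 2))))) (sum-cong-≗ λ i → begin
      F (decode (encode (u i))) + (F (decode (encode (w i))) + (F (decode (encode (w′ i))) + 0))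
        ≡⟨ cong₂ _+_ (at (u i)) (cong₂ _+_ (at (w i)) (cong (_+ 0) (at (w′ i)))) ⟩
      F (u i) + (F (w i) + (F (w′ i) + 0))
        ≡⟨ reassoc₃ (F (u i)) (F (w i)) (F (w′ i)) ⟩
      F (u i) + F (w i) + F (w′ i) ∎))
    (trans (∑-combine a (λ j → F (decode ((b * 3) ↑ʳ j)))) (sum-cong-≗ λ e →
      cong₂ _+_ (at (x e)) (trans (+-identityʳ _) (at (y e))))))
    where
    open ≡-Reasoning
    at : ∀ v → F (decode (encode v)) ≡ F v
    at v = cong F (decode∘encode v)
    reassoc₃ : ∀ l m n → l + (m + (n + 0)) ≡ l + m + n
    reassoc₃ = solve-∀

  -- Degrees in the complement

  K-split : ∀ m i → ⟦ K m i ⟧ + ∑[ e < a ] ⟦ R e m i ⟧ ≡ ⟦ Z m i ⟧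
  -- By `R-disjoint` at most one pair is spliced into a given edge, so an edge of `Z` is either kept
  -- or charged to exactly one pair.
  K-split m i = trans (cong (⟦ K m i ⟧ +_) (∑-any (λ e → R e m i) (λ e e′ → R-disjoint e e′ m i))) split
    where
    split : ⟦ K m i ⟧ + ⟦ any (λ e → R e m i) ⟧ ≡ ⟦ Z m i ⟧
    split with any (λ e → R e m i) in eq
    ... | false = trans (+-identityʳ _) (cong ⟦_⟧ (Bool.∧-identityʳ (Z m i)))
    ... | true  with e , Remi ← any-witness _ eq rewrite R⊆Z e m i Remi = refl

  -- The count common to `u i`, `w i` and `w′ i`. Here `α` and `β` are the links to the other two
  -- layers and `γ` those to the pairs; `ρ e j` says that the link to pair `e` replaces an edge
  -- towards triple `j`. The total is 3 for the own class and `p - 1` for `Z`.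
  module Row (i : Fin b) (α β : Fin b → Bool) (ρ : Fin a → Fin b → Bool) (γ : Fin a → Bool)
             (∑ρ≡γ : ∀ e → ∑[ j < b ] ⟦ ρ e j ⟧ ≡ ⟦ γ e ⟧)
             (split : ∀ j → ⟦ α j ⟧ + ⟦ β j ⟧ + ∑[ e < a ] ⟦ ρ e j ⟧ ≡ ⟦ Z i j ⟧) where

    same : Fin b → Bool
    same j = does (i Fin.≟ j)

    triple : ∀ j → ⟦ same j ⟧ + ⟦ same j ∨ α j ⟧ + ⟦ same j ∨ β j ⟧ ≡ ⟦ same j ⟧ + (⟦ same j ⟧ + ⟦ same j ⟧) + (⟦ α j ⟧ + ⟦ β j ⟧)
    triple j with i Fin.≟ j
    ... | no  _    = refl
    -- At `j = i`, `split` and the irreflexivity of `Z` make `α` and `β` vanish, so the disjunctions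
    -- lose nothing.
    ... | yes refl = cong (3 +_) (sym (m+n≡0⇒m≡0 (⟦ α i ⟧ + ⟦ β i ⟧) (trans (split i) (cong ⟦_⟧ (Z-irrefl i)))))

    row-sum : ∑[ j < b ] (⟦ same j ⟧ + ⟦ same j ∨ α j ⟧ + ⟦ same j ∨ β j ⟧) + ∑[ e < a ] ⟦ γ e ⟧ ≡ 2 + p
    row-sum = begin
      ∑[ j < b ] (⟦ same j ⟧ + ⟦ same j ∨ α j ⟧ + ⟦ same j ∨ β j ⟧) + ∑[ e < a ] ⟦ γ e ⟧
        ≡⟨ cong₂ _+_ (trans (sum-cong-≗ triple) (∑-distrib-+ (λ j → ⟦ same j ⟧ + (⟦ same j ⟧ + ⟦ same j ⟧)) (λ j → ⟦ α j ⟧ + ⟦ β j ⟧)))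
                     (trans (sum-cong-≗ (λ e → sym (∑ρ≡γ e))) (∑-comm (λ e j → ⟦ ρ e j ⟧))) ⟩
      ∑[ j < b ] (⟦ same j ⟧ + (⟦ same j ⟧ + ⟦ same j ⟧)) + ∑[ j < b ] (⟦ α j ⟧ + ⟦ β j ⟧) + ∑[ j < b ] ∑[ e < a ] ⟦ ρ e j ⟧
        ≡⟨ +-assoc (∑[ j < b ] (⟦ same j ⟧ + (⟦ same j ⟧ + ⟦ same j ⟧))) _ _ ⟩
      ∑[ j < b ] (⟦ same j ⟧ + (⟦ same j ⟧ + ⟦ same j ⟧)) + (∑[ j < b ] (⟦ α j ⟧ + ⟦ β j ⟧) + ∑[ j < b ] ∑[ e < a ] ⟦ ρ e j ⟧)
        ≡⟨ cong₂ _+_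
             (trans (∑-distrib-+ (λ j → ⟦ same j ⟧) (λ j → ⟦ same j ⟧ + ⟦ same j ⟧))
                    (cong₂ _+_ (∑-⟦≟⟧ i) (trans (∑-distrib-+ (λ j → ⟦ same j ⟧) (λ j → ⟦ same j ⟧)) (cong₂ _+_ (∑-⟦≟⟧ i) (∑-⟦≟⟧ i)))))
             (trans (sym (∑-distrib-+ (λ j → ⟦ α j ⟧ + ⟦ β j ⟧) (λ j → ∑[ e < a ] ⟦ ρ e j ⟧))) (sum-cong-≗ split)) ⟩
      2 + suc (∑[ j < b ] ⟦ Z i j ⟧)
        ≡⟨ cong (2 +_) (Z-degree i) ⟩
      2 + p ∎
      where open ≡-Reasoning

  <ᶠ-true : ∀ {i j} → i Fin.< j → i <ᶠ j ≡ true
  <ᶠ-true {i} {j} = dec-true (i Fin.<? j)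

  <ᶠ-false : ∀ {i j} → ¬ i Fin.< j → i <ᶠ j ≡ false
  <ᶠ-false {i} {j} = dec-false (i Fin.<? j)

  <ᶠ-sound : ∀ {i j z} → (i <ᶠ j) ∧ z ≡ true → i Fin.< j × z ≡ true
  <ᶠ-sound {i} {j} {z} eq with i Fin.<? j
  ... | yes i<j = i<j , trans (cong (_∧ z) (sym (<ᶠ-true i<j))) eq
  ... | no  i≮j = ⊥-elim (true≢false eq (cong (_∧ z) (<ᶠ-false i≮j)))

  -- Each `j` joined to `i` in `Z` accounts for one link of `u i`: to `w j` if `i < j`, and
  -- otherwise to `w′ j` or, after splicing, to some `y e`. The links of `w i` are analogous; `w′`
  -- is different only in that splicing leads to some `x e`.
  u-split : ∀ i j → ⟦ (i <ᶠ j) ∧ Z i j ⟧ + ⟦ (j <ᶠ i) ∧ K j i ⟧ + ∑[ e < a ] ⟦ (j <ᶠ i) ∧ R e j i ⟧ ≡ ⟦ Z i j ⟧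
  u-split i j with Fin.<-cmp i j
  ... | tri< i<j _ j≮i rewrite <ᶠ-true i<j | <ᶠ-false j≮i =
    trans (cong₂ _+_ (+-identityʳ _) (sum-replicate-zero a)) (+-identityʳ _)
  ... | tri≈ i≮j refl _ rewrite <ᶠ-false i≮j | Z-irrefl i = sum-replicate-zero a
  ... | tri> i≮j _ j<i rewrite <ᶠ-false i≮j | <ᶠ-true j<i = trans (K-split j i) (cong ⟦_⟧ (Z-sym j i))

  w-split : ∀ i j → ⟦ (j <ᶠ i) ∧ Z j i ⟧ + ⟦ (i <ᶠ j) ∧ K j i ⟧ + ∑[ e < a ] ⟦ (i <ᶠ j) ∧ R e j i ⟧ ≡ ⟦ Z i j ⟧
  w-split i j with Fin.<-cmp i j
  ... | tri< i<j _ j≮i rewrite <ᶠ-true i<j | <ᶠ-false j≮i = trans (K-split j i) (cong ⟦_⟧ (Z-sym j i))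
  ... | tri≈ i≮j refl _ rewrite <ᶠ-false i≮j | Z-irrefl i = sum-replicate-zero a
  ... | tri> i≮j _ j<i rewrite <ᶠ-false i≮j | <ᶠ-true j<i =
    trans (cong₂ _+_ (+-identityʳ _) (sum-replicate-zero a)) (trans (+-identityʳ _) (cong ⟦_⟧ (Z-sym j i)))

  w′-split : ∀ m j → ⟦ (m <ᶠ j) ∧ K m j ⟧ + ⟦ (j <ᶠ m) ∧ K m j ⟧ + ∑[ e < a ] ⟦ R e m j ⟧ ≡ ⟦ Z m j ⟧
  w′-split m j with Fin.<-cmp m j
  ... | tri< m<j _ j≮m rewrite <ᶠ-true m<j | <ᶠ-false j≮m =
    trans (cong (_+ ∑[ e < a ] ⟦ R e m j ⟧) (+-identityʳ _)) (K-split m j)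
  ... | tri≈ m≮j refl _ rewrite <ᶠ-false m≮j =
    trans (cong (_+ ∑[ e < a ] ⟦ R e m m ⟧) (sym K≡0)) (K-split m m)
    where
    K≡0 : ⟦ K m m ⟧ ≡ 0
    K≡0 rewrite Z-irrefl m = refl
  ... | tri> m≮j _ j<m rewrite <ᶠ-false m≮j | <ᶠ-true j<m = K-split m j

  -- As `near` contains the loops, the value is `d = 2 + p`, not `d - 1`.
  near-degree : ∀ v → ∑[ i < vertices ] ⟦ near v (decode i) ⟧ ≡ 2 + p
  near-degree v = trans (∑-vertices (λ v′ → ⟦ near v v′ ⟧)) (go v)
    where
    open ≡-Reasoning
    go : ∀ v → ∑[ i < b ] (⟦ near v (u i) ⟧ + ⟦ near v (w i) ⟧ + ⟦ near v (w′ i) ⟧)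
             + ∑[ e < a ] (⟦ near v (x e) ⟧ + ⟦ near v (y e) ⟧) ≡ 2 + p
    go (u i) = trans (cong (_+ ∑[ e < a ] ⟦ link (u i) (y e) ⟧) (sum-cong-≗ λ j → cong (λ s → ⟦ s ⟧ + ⟦ near (u i) (w j) ⟧ + ⟦ near (u i) (w′ j) ⟧) (Bool.∨-identityʳ _)))
      (Row.row-sum i (λ j → (i <ᶠ j) ∧ Z i j) (λ j → (j <ᶠ i) ∧ K j i) (λ e j → (j <ᶠ i) ∧ R e j i) _
        (λ e → ∑-any-∧ (_<ᶠ i) (λ j → R e j i) (λ m m′ → R-injective e m m′ i)) (u-split i))
    -- The own layer, on which `link` is false, is moved to the front, where `row-sum` expects it.
    go (w i) = trans (cong (_+ ∑[ e < a ] ⟦ link (w i) (y e) ⟧) (sum-cong-≗ λ j → trans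
        (cong (_+ ⟦ near (w i) (w′ j) ⟧) (+-comm ⟦ near (w i) (u j) ⟧ _))
        (cong (λ s → ⟦ s ⟧ + ⟦ near (w i) (u j) ⟧ + ⟦ near (w i) (w′ j) ⟧) (Bool.∨-identityʳ _))))
      (Row.row-sum i (λ j → (j <ᶠ i) ∧ Z j i) (λ j → (i <ᶠ j) ∧ K j i) (λ e j → (i <ᶠ j) ∧ R e j i) _
        (λ e → ∑-any-∧ (i <ᶠ_) (λ j → R e j i) (λ m m′ → R-injective e m m′ i)) (w-split i))
    go (w′ i) = trans (cong₂ _+_
        (sum-cong-≗ λ j → trans
          (+-comm (⟦ near (w′ i) (u j) ⟧ + ⟦ near (w′ i) (w j) ⟧) _)
          (trans (sym (+-assoc ⟦ near (w′ i) (w′ j) ⟧ _ _))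
            (cong (λ s → ⟦ s ⟧ + ⟦ near (w′ i) (u j) ⟧ + ⟦ near (w′ i) (w j) ⟧) (Bool.∨-identityʳ _))))
        (sum-cong-≗ λ e → +-identityʳ ⟦ near (w′ i) (x e) ⟧))
      (Row.row-sum i (λ j → (i <ᶠ j) ∧ K i j) (λ j → (j <ᶠ i) ∧ K i j) (λ e j → R e i j) _
        (λ e → ∑-any (R e i) (R-functional e i)) (w′-split i))
    go (x e) = begin
      ∑[ m < b ] ⟦ any (R e m) ⟧ + ∑[ e′ < a ] (⟦ does (e Fin.≟ e′) ∨ false ⟧ + ⟦ does (e Fin.≟ e′) ∨ Y e e′ ⟧)
        ≡⟨ cong₂ _+_ (sum-cong-≗ λ m → sym (∑-any (R e m) (R-functional e m)))
             (trans (sum-cong-≗ λ e′ → cong (λ s → ⟦ s ⟧ + ⟦ does (e Fin.≟ e′) ∨ Y e e′ ⟧) (Bool.∨-identityʳ (does (e Fin.≟ e′))))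
                    (∑-≟∨ e (Y e) (Y-irrefl e))) ⟩
      total + (2 + ∑[ e′ < a ] ⟦ Y e e′ ⟧)  ≡⟨ move total _ ⟩
      2 + (total + ∑[ e′ < a ] ⟦ Y e e′ ⟧)  ≡⟨ cong (2 +_) (x-degree e) ⟩
      2 + p                                 ∎
      where
      total = ∑[ m < b ] ∑[ i < b ] ⟦ R e m i ⟧
      move : ∀ s t → s + (2 + t) ≡ 2 + (s + t)
      move = solve-∀
    go (y e) = begin
      ∑[ i < b ] (⟦ link (y e) (u i) ⟧ + ⟦ link (y e) (w i) ⟧ + 0)
        + ∑[ e′ < a ] (⟦ does (e Fin.≟ e′) ∨ Y e′ e ⟧ + ⟦ does (e Fin.≟ e′) ∨ false ⟧)
        ≡⟨ cong₂ _+_ (trans (sum-cong-≗ column) (sym (∑-comm (λ m i → ⟦ R e m i ⟧))))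
             (trans (sum-cong-≗ λ e′ → trans (+-comm ⟦ does (e Fin.≟ e′) ∨ Y e′ e ⟧ _)
                        (cong (λ s → ⟦ s ⟧ + ⟦ does (e Fin.≟ e′) ∨ Y e′ e ⟧) (Bool.∨-identityʳ (does (e Fin.≟ e′)))))
                    (∑-≟∨ e (λ e′ → Y e′ e) (Y-irrefl e))) ⟩
      total + (2 + ∑[ e′ < a ] ⟦ Y e′ e ⟧)  ≡⟨ move total _ ⟩
      2 + (total + ∑[ e′ < a ] ⟦ Y e′ e ⟧)  ≡⟨ cong (2 +_) (y-degree e) ⟩
      2 + p                                 ∎
      where
      total = ∑[ m < b ] ∑[ i < b ] ⟦ R e m i ⟧
      move : ∀ s t → s + (2 + t) ≡ 2 + (s + t)
      move = solve-∀
      -- A splice joins `y e` to exactly one of `u i` and `w i`; the case `m = i` cannot occur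
      -- because `R` lies in the irreflexive `Z`.
      merge : ∀ i m → ⟦ (m <ᶠ i) ∧ R e m i ⟧ + ⟦ (i <ᶠ m) ∧ R e m i ⟧ ≡ ⟦ R e m i ⟧
      merge i m with Fin.<-cmp m i
      ... | tri< m<i _ i≮m rewrite <ᶠ-true m<i | <ᶠ-false i≮m = +-identityʳ _
      ... | tri> m≮i _ i<m rewrite <ᶠ-false m≮i | <ᶠ-true i<m = refl
      ... | tri≈ m≮i refl _ rewrite <ᶠ-false m≮i with R e m m in Remm
      ...   | false = refl
      ...   | true  = ⊥-elim (true≢false (R⊆Z e m m Remm) (Z-irrefl m))
      column : ∀ i → ⟦ link (y e) (u i) ⟧ + ⟦ link (y e) (w i) ⟧ + 0 ≡ ∑[ m < b ] ⟦ R e m i ⟧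
      column i = begin
        ⟦ link (y e) (u i) ⟧ + ⟦ link (y e) (w i) ⟧ + 0
          ≡⟨ +-identityʳ _ ⟩
        ⟦ link (y e) (u i) ⟧ + ⟦ link (y e) (w i) ⟧
          ≡⟨ cong₂ _+_ (sym (∑-any-∧ (_<ᶠ i) (λ m → R e m i) (λ m m′ → R-injective e m m′ i)))
                       (sym (∑-any-∧ (i <ᶠ_) (λ m → R e m i) (λ m m′ → R-injective e m m′ i))) ⟩
        ∑[ m < b ] ⟦ (m <ᶠ i) ∧ R e m i ⟧ + ∑[ m < b ] ⟦ (i <ᶠ m) ∧ R e m i ⟧
          ≡⟨ sym (∑-distrib-+ (λ m → ⟦ (m <ᶠ i) ∧ R e m i ⟧) (λ m → ⟦ (i <ᶠ m) ∧ R e m i ⟧)) ⟩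
        ∑[ m < b ] (⟦ (m <ᶠ i) ∧ R e m i ⟧ + ⟦ (i <ᶠ m) ∧ R e m i ⟧)
          ≡⟨ sum-cong-≗ (merge i) ⟩
        ∑[ m < b ] ⟦ R e m i ⟧ ∎

  -- Forced colours

  seed : Class → Vertex
  seed (inj₁ i) = u i
  seed (inj₂ e) = if side e then x e else y e

  class-seed : ∀ c → class (seed c) ≡ c
  class-seed (inj₁ i) = refl
  class-seed (inj₂ e) with side e
  ... | true  = refl
  ... | false = refl

  module Forcing (g : Vertex → Class) (proper : ∀ v v′ → near v v′ ≡ false → g v ≢ g v′)
                 (c₀ : Class) (c₀-free : ∀ c → c ≢ c₀ → near (seed c₀) (seed c) ≡ false)
                 (seeded : ∀ c → c ≢ c₀ → g (seed c) ≡ c) where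

    -- The single rule of deduction: `near` being false is adjacency in the graph, so each other
    -- colour is ruled out by a neighbour already known to carry it.
    force : ∀ v c → class v ≡ c → (∀ c′ → c′ ≢ c → ∃ λ v′ → g v′ ≡ c′ × near v v′ ≡ false) → g v ≡ c
    force v c v∈c excluded with g v ≟ᶜ c
    ... | yes gv≡c = gv≡c
    ... | no  gv≢c = let v′ , gv′≡gv , ¬vv′ = excluded (g v) gv≢c in ⊥-elim (proper v v′ ¬vv′ (sym gv′≡gv))

    seed-forced : ∀ c → g (seed c) ≡ c
    seed-forced c with c ≟ᶜ c₀
    ... | no  c≢c₀ = seeded c c≢c₀
    ... | yes refl = force (seed c) c (class-seed c) (λ c′ c′≢c → seed c′ , seeded c′ c′≢c , c₀-free c′ c′≢c)

    x-seed : ∀ e → side e ≡ true → g (x e) ≡ inj₂ e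
    x-seed e eq with side e | seed-forced (inj₂ e)
    ... | true | forced = forced

    y-seed : ∀ e → side e ≡ false → g (y e) ≡ inj₂ e
    y-seed e eq with side e | seed-forced (inj₂ e)
    ... | false | forced = forced

    -- Every `u` and every other `x` is adjacent to `x e`. For an uncoloured `x e`, a pair `e′` of
    -- the same side is excluded by its seed `y e′`, unless `Y e e′`; then `e < e′`, so downward
    -- induction supplies `x e′`.
    x-forced : ∀ e → g (x e) ≡ inj₂ e
    x-forced e = go e (>-wellFounded e)
      where
      go : ∀ e → Acc Fin._>_ e → g (x e) ≡ inj₂ e
      go e (acc rec) with side e in sₑ
      ... | true  = x-seed e sₑ
      ... | false = force (x e) (inj₂ e) refl excluded
        where
        excluded : ∀ c → c ≢ inj₂ e → ∃ λ v → g v ≡ c × near (x e) v ≡ false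
        excluded (inj₁ i)  _    = u i , seed-forced (inj₁ i) , refl
        excluded (inj₂ e′) e′≢e with side e′ in sₑ′
        ... | true  = x e′ , x-seed e′ sₑ′ , ¬near {x e} {x e′} (e′≢e ∘ sym) refl
        ... | false with Y e e′ in Yee′
        ...   | false = y e′ , y-seed e′ sₑ′ , ¬near {x e} {y e′} (e′≢e ∘ sym) Yee′
        ...   | true  = x e′ , go e′ (rec (Y-triangular e e′ (trans sₑ (sym sₑ′)) Yee′)) ,
                        ¬near {x e} {x e′} (e′≢e ∘ sym) refl

    -- Only `u j` with `j < i` can be linked to `w i`, and then `w j`, forced earlier, excludes the
    -- colour instead.
    w-forced : ∀ i → g (w i) ≡ inj₁ i
    w-forced i = go i (<-wellFounded i)
      where
      go : ∀ i → Acc Fin._<_ i → g (w i) ≡ inj₁ i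
      go i (acc rec) = force (w i) (inj₁ i) refl excluded
        where
        excluded : ∀ c → c ≢ inj₁ i → ∃ λ v → g v ≡ c × near (w i) v ≡ false
        excluded (inj₂ e) _   = x e , x-forced e , refl
        excluded (inj₁ j) j≢i with link (w i) (u j) in lᵢⱼ
        ... | false = u j , seed-forced (inj₁ j) , ¬near {w i} {u j} (j≢i ∘ sym) lᵢⱼ
        ... | true  = w j , go j (rec (proj₁ (<ᶠ-sound lᵢⱼ))) , ¬near {w i} {w j} (j≢i ∘ sym) refl

    y-forced : ∀ e → g (y e) ≡ inj₂ e
    y-forced e = go e (<-wellFounded e)
      where
      go : ∀ e → Acc Fin._<_ e → g (y e) ≡ inj₂ e
      go e (acc rec) with side e in sₑ
      ... | false = y-seed e sₑ
      ... | true  = force (y e) (inj₂ e) refl excluded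
        where
        excluded : ∀ c → c ≢ inj₂ e → ∃ λ v → g v ≡ c × near (y e) v ≡ false
        excluded (inj₁ i) _ with link (y e) (u i) in lᵤ | link (y e) (w i) in lw
        ... | false | _     = u i , seed-forced (inj₁ i) , ¬near {y e} {u i} (λ ()) lᵤ
        ... | true  | false = w i , w-forced i , ¬near {y e} {w i} (λ ()) lw
        -- Links to both `u i` and `w i` would come from splices at some `m < i` and some `m′ > i`,
        -- against `R-injective`.
        ... | true  | true  =
          let m  , lm  = any-witness _ lᵤ
              m′ , lm′ = any-witness _ lw
              m<i  , Rm  = <ᶠ-sound lm
              i<m′ , Rm′ = <ᶠ-sound lm′
          in ⊥-elim (<-irrefl (cong toℕ (R-injective e m m′ i Rm Rm′)) (<-trans m<i i<m′))
        excluded (inj₂ e′) e′≢e with side e′ in sₑ′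
        ... | false = y e′ , y-seed e′ sₑ′ , ¬near {y e} {y e′} (e′≢e ∘ sym) refl
        ... | true  with Y e′ e in Ye′e
        ...   | false = x e′ , x-seed e′ sₑ′ , ¬near {y e} {x e′} (e′≢e ∘ sym) Ye′e
        ...   | true  = y e′ , go e′ (rec (Y-triangular e′ e (trans sₑ′ (sym sₑ)) Ye′e)) ,
                        ¬near {y e} {y e′} (e′≢e ∘ sym) refl

    w′-forced : ∀ m → g (w′ m) ≡ inj₁ m
    w′-forced m = force (w′ m) (inj₁ m) refl excluded
      where
      excluded : ∀ c → c ≢ inj₁ m → ∃ λ v → g v ≡ c × near (w′ m) v ≡ false
      excluded (inj₂ e) _   = y e , y-forced e , refl
      excluded (inj₁ i) i≢m with link (w′ m) (u i) in lᵤ | link (w′ m) (w i) in lw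
      ... | false | _     = u i , seed-forced (inj₁ i) , ¬near {w′ m} {u i} (i≢m ∘ sym) lᵤ
      ... | true  | false = w i , w-forced i , ¬near {w′ m} {w i} (i≢m ∘ sym) lw
      -- The two links would require `m < i` and `i < m`.
      ... | true  | true  = ⊥-elim (<-asym (proj₁ (<ᶠ-sound {m} {i} lᵤ)) (proj₁ (<ᶠ-sound {i} {m} lw)))

    all-forced : ∀ v → g v ≡ class v
    all-forced (u i)  = seed-forced (inj₁ i)
    all-forced (w i)  = w-forced i
    all-forced (w′ i) = w′-forced i
    all-forced (x e)  = x-forced e
    all-forced (y e)  = y-forced e

  -- Chromatic number and defining set

  representative : Class → Vertex
  representative (inj₁ i) = u i
  representative (inj₂ e) = x e

  -- This is the clique bounding the chromatic number from below. The seeds would not do: a seed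
  -- `y e` may be linked to some `u` or to a seed `x`.
  representatives-apart : ∀ c c′ → c ≢ c′ → near (representative c) (representative c′) ≡ false
  representatives-apart (inj₁ i) (inj₁ j)  c≢c′ = ¬near {u i} {u j} c≢c′ refl
  representatives-apart (inj₁ i) (inj₂ e)  c≢c′ = refl
  representatives-apart (inj₂ e) (inj₁ i)  c≢c′ = refl
  representatives-apart (inj₂ e) (inj₂ e′) c≢c′ = ¬near {x e} {x e′} c≢c′ refl

  graph : Graph vertices
  graph = record
    { adj     = λ i j → not (near (decode i) (decode j))
    ; adj-sym = λ i j → cong not (near-sym (decode i) (decode j))
    ; irrefl  = λ i → cong not (same-class⇒near (decode i) (decode i) refl)
    }

  adj-encode : ∀ {v v′} → near v v′ ≡ false → adj graph (encode v) (encode v′) ≡ true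
  adj-encode {v} {v′} ¬vv′ = cong not (trans (cong₂ near (decode∘encode v) (decode∘encode v′)) ¬vv′)

  graph-regular : ∀ {r} → r + (2 + p) ≡ vertices → Regular r graph
  graph-regular {r} r+d≡n i = +-cancelʳ-≡ (2 + p) _ _ (begin
    degree graph i + (2 + p)
      ≡⟨ cong₂ _+_ (degree≡∑ graph i) (sym (near-degree (decode i))) ⟩
    ∑[ j < vertices ] ⟦ not (near (decode i) (decode j)) ⟧ + ∑[ j < vertices ] ⟦ near (decode i) (decode j) ⟧
      ≡⟨ sym (∑-distrib-+ (λ j → ⟦ not (near (decode i) (decode j)) ⟧) (λ j → ⟦ near (decode i) (decode j) ⟧)) ⟩
    ∑[ j < vertices ] (⟦ not (near (decode i) (decode j)) ⟧ + ⟦ near (decode i) (decode j) ⟧)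
      ≡⟨ sum-cong-≗ (λ j → ⟦not⟧+⟦⟧ (near (decode i) (decode j))) ⟩
    ∑[ j < vertices ] 1
      ≡⟨ ∑-one vertices ⟩
    vertices
      ≡⟨ sym r+d≡n ⟩
    r + (2 + p) ∎)
    where open ≡-Reasoning

  join-injective : ∀ {c c′} → join b a c ≡ join b a c′ → c ≡ c′
  join-injective {c} {c′} eq = trans (sym (Fin.splitAt-join b a c)) (trans (cong (splitAt b) eq) (Fin.splitAt-join b a c′))

  splitAt-injective : ∀ {i j : Fin (b + a)} → splitAt b i ≡ splitAt b j → i ≡ j
  splitAt-injective {i} {j} eq = trans (sym (Fin.join-splitAt b a i)) (trans (cong (join b a) eq) (Fin.join-splitAt b a j))

  colouring : Coloring vertices (b + a)
  colouring = join b a ∘ class ∘ decode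

  colouring-proper : IsProper graph colouring
  colouring-proper i j ij eq
    rewrite same-class⇒near (decode i) (decode j) (join-injective eq) with () ← ij

  graph-chromatic : ChromaticNumber graph (b + a)
  graph-chromatic = (colouring , colouring-proper) , λ m m<k (h , h-proper) →
    let c , c′ , c<c′ , eq = Fin.pigeonhole m<k (h ∘ encode ∘ representative ∘ splitAt b)
    in h-proper _ _ (adj-encode {representative (splitAt b c)} {representative (splitAt b c′)} (representatives-apart (splitAt b c) (splitAt b c′) (Fin.<⇒≢ c<c′ ∘ splitAt-injective))) eq

  module Defining (c₀ : Class) (c₀-free : ∀ c → c ≢ c₀ → near (seed c₀) (seed c) ≡ false) where

    is-seed : Vertex → Bool
    is-seed (u _)  = true
    is-seed (w _)  = false
    is-seed (w′ _) = false
    is-seed (x e)  = side e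
    is-seed (y e)  = not (side e)

    chosen : Vertex → Bool
    chosen v = is-seed v ∧ not (does (c₀ ≟ᶜ class v))

    partial : PartialColoring vertices (b + a)
    partial i = if chosen (decode i) then just (colouring i) else nothing

    is-just-partial : ∀ i → is-just (partial i) ≡ chosen (decode i)
    is-just-partial i with chosen (decode i)
    ... | true  = refl
    ... | false = refl

    ∑-≟ᶜ : ∀ c → ∑[ i < b ] ⟦ does (c ≟ᶜ inj₁ i) ⟧ + ∑[ e < a ] ⟦ does (c ≟ᶜ inj₂ e) ⟧ ≡ 1
    ∑-≟ᶜ (inj₁ i) = cong₂ _+_ (∑-⟦≟⟧ i) (sum-replicate-zero a)
    ∑-≟ᶜ (inj₂ e) = cong₂ _+_ (sum-replicate-zero b) (∑-⟦≟⟧ e)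

    size-partial : size partial ≡ b + a ∸ 1
    -- The added 1 stands for the class `c₀`, so that a sum over the chosen classes and its
    -- complement together count all `b + a` classes.
    size-partial = trans (sym (m+n∸n≡m (size partial) 1)) (cong (_∸ 1) (begin
      size partial + 1
        ≡⟨ cong₂ _+_ (trans (list-sum≡∑ (λ i → ⟦ is-just (partial i) ⟧))
                     (trans (sum-cong-≗ (λ i → cong ⟦_⟧ (is-just-partial i)))
                     (trans (∑-vertices (λ v → ⟦ chosen v ⟧)) (cong₂ _+_ (sum-cong-≗ triple) (sum-cong-≗ pair)))))
                     (sym (∑-≟ᶜ c₀)) ⟩
      ∑[ i < b ] ⟦ not (does (c₀ ≟ᶜ inj₁ i)) ⟧ + ∑[ e < a ] ⟦ not (does (c₀ ≟ᶜ inj₂ e)) ⟧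
        + (∑[ i < b ] ⟦ does (c₀ ≟ᶜ inj₁ i) ⟧ + ∑[ e < a ] ⟦ does (c₀ ≟ᶜ inj₂ e) ⟧)
        ≡⟨ interchange (∑[ i < b ] ⟦ not (does (c₀ ≟ᶜ inj₁ i)) ⟧) _ _ _ ⟩
      ∑[ i < b ] ⟦ not (does (c₀ ≟ᶜ inj₁ i)) ⟧ + ∑[ i < b ] ⟦ does (c₀ ≟ᶜ inj₁ i) ⟧
        + (∑[ e < a ] ⟦ not (does (c₀ ≟ᶜ inj₂ e)) ⟧ + ∑[ e < a ] ⟦ does (c₀ ≟ᶜ inj₂ e) ⟧)
        ≡⟨ cong₂ _+_ (complement (λ i → does (c₀ ≟ᶜ inj₁ i))) (complement (λ e → does (c₀ ≟ᶜ inj₂ e))) ⟩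
      b + a ∎))
      where
      open ≡-Reasoning
      triple : ∀ i → ⟦ chosen (u i) ⟧ + 0 + 0 ≡ ⟦ not (does (c₀ ≟ᶜ inj₁ i)) ⟧
      triple i = trans (+-identityʳ _) (+-identityʳ _)
      pair : ∀ e → ⟦ chosen (x e) ⟧ + ⟦ chosen (y e) ⟧ ≡ ⟦ not (does (c₀ ≟ᶜ inj₂ e)) ⟧
      pair e with side e
      ... | true  = +-identityʳ _
      ... | false = refl
      complement : ∀ {n} (P : Fin n → Bool) → ∑[ i < n ] ⟦ not (P i) ⟧ + ∑[ i < n ] ⟦ P i ⟧ ≡ n
      complement {n} P = trans (sym (∑-distrib-+ (λ i → ⟦ not (P i) ⟧) (λ i → ⟦ P i ⟧)))
        (trans (sum-cong-≗ (λ i → ⟦not⟧+⟦⟧ (P i))) (∑-one n))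

    colouring-extends : Extends colouring partial
    colouring-extends i z eq with chosen (decode i)
    ... | true = just-injective eq

    chosen-seed : ∀ c → c ≢ c₀ → chosen (seed c) ≡ true
    chosen-seed (inj₁ i) c≢c₀ = cong not (dec-false (c₀ ≟ᶜ inj₁ i) (c≢c₀ ∘ sym))
    chosen-seed (inj₂ e) c≢c₀ with side e in sₑ
    ... | true  rewrite sₑ = cong not (dec-false (c₀ ≟ᶜ inj₂ e) (c≢c₀ ∘ sym))
    ... | false rewrite sₑ = cong not (dec-false (c₀ ≟ᶜ inj₂ e) (c≢c₀ ∘ sym))

    partial-seed : ∀ c → c ≢ c₀ → partial (encode (seed c)) ≡ just (join b a c)
    partial-seed c c≢c₀ rewrite decode∘encode (seed c) | chosen-seed c c≢c₀ = cong (just ∘ join b a) (class-seed c)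

    unique : ∀ g → IsProper graph g → Extends g partial → ∀ i → g i ≡ colouring i
    unique g g-proper g-extends i = begin
      g i                                          ≡⟨ cong g (sym (encode∘decode i)) ⟩
      g (encode (decode i))                        ≡⟨ sym (Fin.join-splitAt b a _) ⟩
      join b a (splitAt b (g (encode (decode i)))) ≡⟨ cong (join b a) (all-forced (decode i)) ⟩
      colouring i                                  ∎
      where
      open ≡-Reasoning
      open Forcing (splitAt b ∘ g ∘ encode)
        (λ v v′ ¬vv′ eq → g-proper (encode v) (encode v′) (adj-encode {v} {v′} ¬vv′) (splitAt-injective eq))
        c₀ c₀-free
        (λ c c≢c₀ → trans (cong (splitAt b) (g-extends _ _ (partial-seed c c≢c₀))) (Fin.splitAt-join b a c))

    partial-defining : IsDefiningSet graph partial
    partial-defining = colouring , colouring-proper , colouring-extends , unique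

    defining-number : DefiningNumber graph (b + a) (b + a ∸ 1)
    defining-number = (partial , partial-defining , size-partial) , defining-set-size {G = graph} graph-chromatic

  -- A link from `u i₀` to some `y e` needs an index `m` below `i₀`, and there is none. Hence the
  -- first triple can be the class left out.
  first-class-free : ∀ i₀ → toℕ i₀ ≡ 0 → ∀ c → c ≢ inj₁ i₀ → near (u i₀) (seed c) ≡ false
  first-class-free i₀ i₀≡0 (inj₁ j) c≢ = ¬near {u i₀} {u j} (c≢ ∘ sym) refl
  first-class-free i₀ i₀≡0 (inj₂ e) c≢ with side e
  ... | true  = refl
  ... | false = any-false (λ m → (m <ᶠ i₀) ∧ R e m i₀)
    (λ m → cong (_∧ R e m i₀) (<ᶠ-false {m} {i₀} (λ m<i₀ → n≮0 (subst (toℕ m <_) i₀≡0 m<i₀))))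

  -- With `p = 0` there are no triples, and the degree conditions leave `Y` empty, so any pair can
  -- be left out.
  isolated-class-free : p ≡ 0 → ∀ e₀ c → c ≢ inj₂ e₀ → near (seed (inj₂ e₀)) (seed c) ≡ false
  isolated-class-free p≡0 e₀ (inj₁ i) c≢ with () ← trans (Z-degree i) p≡0
  isolated-class-free p≡0 e₀ (inj₂ e) c≢ with side e₀ | side e
  ... | true  | true  = ¬near {x e₀} {x e} (c≢ ∘ sym) refl
  ... | false | false = ¬near {y e₀} {y e} (c≢ ∘ sym) refl
  ... | true  | false = ¬near {x e₀} {y e} (c≢ ∘ sym) (⟦⟧≡0⇒false
    (∑≡0⇒≡0 (λ e′ → ⟦ Y e₀ e′ ⟧) (m+n≡0⇒n≡0 _ (trans (x-degree e₀) p≡0)) e))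
  ... | false | true  = ¬near {y e₀} {x e} (c≢ ∘ sym) (⟦⟧≡0⇒false
    (∑≡0⇒≡0 (λ e′ → ⟦ Y e′ e₀ ⟧) (m+n≡0⇒n≡0 _ (trans (y-degree e₀) p≡0)) e))

realise : ∀ {b a p r} → Blueprint b a p → 0 < b ⊎ (p ≡ 0 × 0 < a) → r + (2 + p) ≡ b * 3 + a * 2 →
          Σ (Graph (b * 3 + a * 2)) λ G → InClass (b * 3 + a * 2) r (b + a) G × DefiningNumber G (b + a) (b + a ∸ 1)
realise {suc b} B (inj₁ _) r+d≡n = Construction.graph B , (Construction.graph-regular B r+d≡n , Construction.graph-chromatic B) ,
  Construction.Defining.defining-number B (inj₁ zero) (Construction.first-class-free B zero refl)
realise {a = suc a} B (inj₂ (p≡0 , _)) r+d≡n = Construction.graph B , (Construction.graph-regular B r+d≡n , Construction.graph-chromatic B) ,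
  Construction.Defining.defining-number B (inj₂ zero) (Construction.isolated-class-free B p≡0 zero)

-- Circulant relations

∑-involution : ∀ {n} (φ : Fin n → Fin n) → (∀ i → φ (φ i) ≡ i) → (F : Fin n → ℕ) →
               ∑[ i < n ] F (φ i) ≡ ∑[ i < n ] F i
∑-involution φ φφ F = sym (sum-permute F (permutation φ φ φφ φφ))

∑-< : ∀ {n} h → h ≤ n → ∑[ s < n ] ⟦ does (toℕ s <? h) ⟧ ≡ h
∑-< {n}     zero    _         = sum-replicate-zero n
∑-< {suc n} (suc h) (s≤s h≤n) = cong suc (∑-< h h≤n)

-- Used to choose distinct shifts from a connection set.
enumerate : ∀ {n} (P : Fin n → Bool) → Σ (Fin (∑[ i < n ] ⟦ P i ⟧) → Fin n) λ δ →
            (∀ j → P (δ j) ≡ true) × (∀ j j′ → δ j ≡ δ j′ → j ≡ j′)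
enumerate {zero}  P = (λ ()) , (λ ()) , (λ ())
enumerate {suc n} P with P zero in P0 | enumerate (P ∘ suc)
... | false | δ , sound , inj = suc ∘ δ , sound , (λ j j′ → inj j j′ ∘ Fin.suc-injective)
... | true  | δ , sound , inj = δ⁺ , sound⁺ , inj⁺
  where
  δ⁺ : Fin (suc (∑[ i < n ] ⟦ P (suc i) ⟧)) → Fin (suc n)
  δ⁺ zero    = zero
  δ⁺ (suc j) = suc (δ j)
  sound⁺ : ∀ j → P (δ⁺ j) ≡ true
  sound⁺ zero    = P0
  sound⁺ (suc j) = sound j
  inj⁺ : ∀ j j′ → δ⁺ j ≡ δ⁺ j′ → j ≡ j′
  inj⁺ zero    zero     _  = refl
  inj⁺ (suc j) (suc j′) eq = cong suc (inj j j′ (Fin.suc-injective eq))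

∑-∨ : ∀ {n} (P Q : Fin n → Bool) → (∀ i → P i ≡ true → Q i ≡ true → ⊥) →
      ∑[ i < n ] ⟦ P i ∨ Q i ⟧ ≡ ∑[ i < n ] ⟦ P i ⟧ + ∑[ i < n ] ⟦ Q i ⟧
∑-∨ P Q disjoint = trans (sum-cong-≗ pointwise) (∑-distrib-+ (λ i → ⟦ P i ⟧) (λ i → ⟦ Q i ⟧))
  where
  pointwise : ∀ i → ⟦ P i ∨ Q i ⟧ ≡ ⟦ P i ⟧ + ⟦ Q i ⟧
  pointwise i with P i in Pi | Q i in Qi
  ... | false | _     = refl
  ... | true  | false = refl
  ... | true  | true  = ⊥-elim (disjoint i Pi Qi)

does-sound : ∀ {A : Set} (d : Dec A) → does d ≡ true → A
does-sound (yes x) _ = x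

-- Subtraction modulo n, characterised by i + (j ⊖ i) ∈ {j , n + j}.
module Cyclic {n : ℕ} where

  Difference : (i j t : Fin n) → Set
  Difference i j t = toℕ i + toℕ t ≡ toℕ j ⊎ toℕ i + toℕ t ≡ n + toℕ j

  difference : (j i : Fin n) → ∃ (Difference i j)
  difference j i with toℕ i ≤? toℕ j
  ... | yes i≤j = fromℕ< (≤-<-trans (m∸n≤m (toℕ j) (toℕ i)) (Fin.toℕ<n j)) ,
                  inj₁ (trans (cong (toℕ i +_) (Fin.toℕ-fromℕ< _)) (m+[n∸m]≡n i≤j))
  ... | no  i≰j = fromℕ< bound ,
                  inj₂ (trans (cong (toℕ i +_) (Fin.toℕ-fromℕ< bound)) (m+[n∸m]≡n i≤n+j))
    where
    i≤n+j : toℕ i ≤ n + toℕ j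
    i≤n+j = ≤-trans (<⇒≤ (Fin.toℕ<n i)) (m≤m+n n (toℕ j))
    bound : n + toℕ j ∸ toℕ i < n
    bound = subst (n + toℕ j ∸ toℕ i <_) (m+n∸n≡m n (toℕ i)) (∸-monoˡ-< (+-monoʳ-< n (≰⇒> i≰j)) i≤n+j)

  _⊖_ : Fin n → Fin n → Fin n
  j ⊖ i = proj₁ (difference j i)

  ⊖-spec : ∀ j i → Difference i j (j ⊖ i)
  ⊖-spec j i = proj₂ (difference j i)

  too-large : ∀ {m} (i : Fin n) → toℕ i ≡ n + m → ⊥
  too-large {m} i eq = <-irrefl refl (<-≤-trans (Fin.toℕ<n i) (subst (n ≤_) (sym eq) (m≤m+n n m)))

  ⊖-unique : ∀ {i j t t′} → Difference i j t → Difference i j t′ → t ≡ t′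
  ⊖-unique {i} (inj₁ p) (inj₁ q) = Fin.toℕ-injective (+-cancelˡ-≡ (toℕ i) _ _ (trans p (sym q)))
  ⊖-unique {i} (inj₂ p) (inj₂ q) = Fin.toℕ-injective (+-cancelˡ-≡ (toℕ i) _ _ (trans p (sym q)))
  ⊖-unique {i} {j} {t} {t′} (inj₁ p) (inj₂ q) = ⊥-elim (too-large t′ (+-cancelˡ-≡ (toℕ i) _ _
    (trans q (trans (cong (n +_) (sym p)) (swap n (toℕ i) (toℕ t))))))
    where
    swap : ∀ a b c → a + (b + c) ≡ b + (a + c)
    swap = solve-∀
  ⊖-unique {i} {j} {t} {t′} d@(inj₂ _) d′@(inj₁ _) = sym (⊖-unique {i} {j} d′ d)

  -- `Difference i j t` is symmetric in `i` and `t`.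
  ⊖-involutive : ∀ j i → j ⊖ (j ⊖ i) ≡ i
  ⊖-involutive j i = ⊖-unique {j ⊖ i} {j} (⊖-spec j (j ⊖ i)) (flip {i} {j ⊖ i} (⊖-spec j i))
    where
    flip : ∀ {i t} → Difference i j t → Difference t j i
    flip {i} {t} (inj₁ p) = inj₁ (trans (+-comm (toℕ t) (toℕ i)) p)
    flip {i} {t} (inj₂ p) = inj₂ (trans (+-comm (toℕ t) (toℕ i)) p)

  ⊖-injectiveˡ : ∀ i j j′ → j ⊖ i ≡ j′ ⊖ i → j ≡ j′
  ⊖-injectiveˡ i j j′ eq with ⊖-spec j i | ⊖-spec j′ i
  ... | inj₁ p | inj₁ q = Fin.toℕ-injective (trans (sym p) (trans (cong (λ t → toℕ i + toℕ t) eq) q))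
  ... | inj₂ p | inj₂ q = Fin.toℕ-injective (+-cancelˡ-≡ n _ _ (trans (sym p) (trans (cong (λ t → toℕ i + toℕ t) eq) q)))
  ... | inj₁ p | inj₂ q = ⊥-elim (too-large j (trans (sym p) (trans (cong (λ t → toℕ i + toℕ t) eq) q)))
  ... | inj₂ p | inj₁ q = ⊥-elim (too-large j′ (trans (sym q) (trans (cong (λ t → toℕ i + toℕ t) (sym eq)) p)))

  ⊖-injectiveʳ : ∀ j i i′ → j ⊖ i ≡ j ⊖ i′ → i ≡ i′
  ⊖-injectiveʳ j i i′ eq = trans (sym (⊖-involutive j i)) (trans (cong (j ⊖_) eq) (⊖-involutive j i′))

  sum-difference : ∀ m (i j t t′ : Fin n) → (toℕ i + toℕ t) + (toℕ j + toℕ t′) ≡ m + (toℕ i + toℕ j) →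
                   toℕ t + toℕ t′ ≡ m
  sum-difference m i j t t′ eq = +-cancelʳ-≡ (toℕ i + toℕ j) _ m (trans (regroup (toℕ i) (toℕ j) (toℕ t) (toℕ t′)) eq)
    where
    regroup : ∀ i j t t′ → (t + t′) + (i + j) ≡ (i + t) + (j + t′)
    regroup = solve-∀

  -- Adding the two specifications shows that the sum is a multiple of `n`; it is less than `2n`.
  ⊖-opposite : ∀ i j → toℕ (j ⊖ i) + toℕ (i ⊖ j) ≡ 0 ⊎ toℕ (j ⊖ i) + toℕ (i ⊖ j) ≡ n
  ⊖-opposite i j with ⊖-spec j i | ⊖-spec i j
  ... | inj₁ p | inj₁ q = inj₁ (sum-difference 0 i j (j ⊖ i) (i ⊖ j) (trans (cong₂ _+_ p q) (+-comm (toℕ j) (toℕ i))))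
  ... | inj₁ p | inj₂ q = inj₂ (sum-difference n i j (j ⊖ i) (i ⊖ j) (trans (cong₂ _+_ p q) (lemma (toℕ i) (toℕ j) n)))
    where
    lemma : ∀ i j n → j + (n + i) ≡ n + (i + j)
    lemma = solve-∀
  ... | inj₂ p | inj₁ q = inj₂ (sum-difference n i j (j ⊖ i) (i ⊖ j) (trans (cong₂ _+_ p q) (lemma (toℕ i) (toℕ j) n)))
    where
    lemma : ∀ i j n → n + j + i ≡ n + (i + j)
    lemma = solve-∀
  ... | inj₂ p | inj₂ q = ⊥-elim (<-irrefl
      (sum-difference (n + n) i j (j ⊖ i) (i ⊖ j) (trans (cong₂ _+_ p q) (lemma (toℕ i) (toℕ j) n)))
      (+-mono-< (Fin.toℕ<n (j ⊖ i)) (Fin.toℕ<n (i ⊖ j))))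
    where
    lemma : ∀ i j n → n + j + (n + i) ≡ n + n + (i + j)
    lemma = solve-∀

open Cyclic

∑-⊖ʳ : ∀ {n} (F : Fin n → ℕ) j → ∑[ i < n ] F (j ⊖ i) ≡ ∑[ t < n ] F t
∑-⊖ʳ F j = ∑-involution (j ⊖_) (⊖-involutive j) F

-- A translation need not be an involution, but it is a composite of two reflections: `j ⊖ i` is
-- `zero ⊖ (i ⊖ j)`.
∑-⊖ˡ : ∀ {n} (F : Fin n → ℕ) i → ∑[ j < n ] F (j ⊖ i) ≡ ∑[ t < n ] F t
∑-⊖ˡ {suc n} F i = trans (sum-cong-≗ (λ j → cong F (negate j)))
  (trans (∑-⊖ʳ (λ t → F (zero ⊖ t)) i) (∑-⊖ʳ F zero))
  where
  negate : ∀ j → j ⊖ i ≡ zero ⊖ (i ⊖ j)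
  negate j = ⊖-unique {i = i ⊖ j} {zero} (difference-zero (⊖-opposite j i)) (⊖-spec zero (i ⊖ j))
    where
    difference-zero : toℕ (i ⊖ j) + toℕ (j ⊖ i) ≡ 0 ⊎ toℕ (i ⊖ j) + toℕ (j ⊖ i) ≡ suc n → Difference (i ⊖ j) zero (j ⊖ i)
    difference-zero (inj₁ eq) = inj₁ eq
    difference-zero (inj₂ eq) = inj₂ (trans eq (sym (+-identityʳ (suc n))))

-- The connection set of a `q`-regular circulant graph on the residues modulo `n`: without 0, and
-- closed under negation.
record ConnectionSet (n q : ℕ) : Set where
  field
    D      : Fin n → Bool
    D-zero : ∀ t → toℕ t ≡ 0 → D t ≡ false
    D-sym  : ∀ t t′ → toℕ t + toℕ t′ ≡ n → D t ≡ D t′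
    D-size : ∑[ t < n ] ⟦ D t ⟧ ≡ q

-- Index `s` stands for the residue `s + 1` modulo `N + 1`, so negation becomes `opposite`. The set
-- consists of the `h` lowest and `h` highest indices and a symmetric set `mid`, which will be empty
-- or the centre.
module Palindrome {N : ℕ} (h : ℕ) (mid : Fin N → Bool) (mid-opposite : ∀ s → mid (opposite s) ≡ mid s) where

  low : Fin N → Bool
  low s = does (toℕ s <? h)

  palindrome : Fin N → Bool
  palindrome s = (low s ∨ low (opposite s)) ∨ mid s

  connection-set : ∀ {q} → h + h ≤ N → (∀ s → low s ≡ true → mid s ≡ true → ⊥) →
                   h + h + ∑[ s < N ] ⟦ mid s ⟧ ≡ q → ConnectionSet (suc N) q
  connection-set {q} h+h≤N low-mid count = record
    { D      = D
    ; D-zero = D-zero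
    ; D-sym  = D-sym
    ; D-size = D-size
    }
    where
    D : Fin (suc N) → Bool
    D zero    = false
    D (suc s) = palindrome s
    D-zero : ∀ t → toℕ t ≡ 0 → D t ≡ false
    D-zero zero _ = refl
    toℕ-opposite : ∀ (s : Fin N) → toℕ s + suc (toℕ (opposite s)) ≡ N
    toℕ-opposite s = begin
      toℕ s + suc (toℕ (opposite s))  ≡⟨ +-suc (toℕ s) _ ⟩
      suc (toℕ s) + toℕ (opposite s)  ≡⟨ cong (suc (toℕ s) +_) (Fin.opposite-prop s) ⟩
      suc (toℕ s) + (N ∸ suc (toℕ s)) ≡⟨ m+[n∸m]≡n (Fin.toℕ<n s) ⟩
      N                               ∎
      where open ≡-Reasoning
    palindromic : ∀ s → palindrome (opposite s) ≡ palindrome s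
    palindromic s = cong₂ _∨_
      (trans (cong (λ s′ → low (opposite s) ∨ low s′) (Fin.opposite-involutive s)) (Bool.∨-comm (low (opposite s)) (low s)))
      (mid-opposite s)
    D-sym : ∀ t t′ → toℕ t + toℕ t′ ≡ suc N → D t ≡ D t′
    D-sym zero    t′       eq = ⊥-elim (<-irrefl eq (Fin.toℕ<n t′))
    D-sym (suc s) zero     eq = ⊥-elim (<-irrefl (trans (sym (+-identityʳ _)) eq) (Fin.toℕ<n (suc s)))
    D-sym (suc s) (suc s′) eq = trans (sym (palindromic s)) (cong palindrome (Fin.toℕ-injective
      (suc-injective (+-cancelˡ-≡ (toℕ s) _ _ (trans (toℕ-opposite s) (sym (suc-injective eq)))))))
    low-high : ∀ s → low s ≡ true → low (opposite s) ≡ true → ⊥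
    low-high s l l′ = <-irrefl refl (begin-strict
      N                                    ≡⟨ sym (toℕ-opposite s) ⟩
      toℕ s + suc (toℕ (opposite s))       <⟨ +-mono-<-≤ (does-sound (toℕ s <? h) l) (does-sound (toℕ (opposite s) <? h) l′) ⟩
      h + h                                ≤⟨ h+h≤N ⟩
      N                                    ∎)
      where open ≤-Reasoning
    D-size : ∑[ s < N ] ⟦ palindrome s ⟧ ≡ q
    D-size = begin
      ∑[ s < N ] ⟦ palindrome s ⟧
        ≡⟨ ∑-∨ (λ s → low s ∨ low (opposite s)) mid disjoint ⟩
      ∑[ s < N ] ⟦ low s ∨ low (opposite s) ⟧ + ∑[ s < N ] ⟦ mid s ⟧
        ≡⟨ cong (_+ ∑[ s < N ] ⟦ mid s ⟧) (trans (∑-∨ low (low ∘ opposite) low-high)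
             (cong₂ _+_ ∑-low (trans (∑-involution opposite Fin.opposite-involutive (λ s → ⟦ low s ⟧)) ∑-low))) ⟩
      h + h + ∑[ s < N ] ⟦ mid s ⟧
        ≡⟨ count ⟩
      q ∎
      where
      open ≡-Reasoning
      ∑-low : ∑[ s < N ] ⟦ low s ⟧ ≡ h
      ∑-low = ∑-< h (≤-trans (m≤m+n h h) h+h≤N)
      disjoint : ∀ s → low s ∨ low (opposite s) ≡ true → mid s ≡ true → ⊥
      disjoint s l m with low s in ls
      ... | true  = low-mid s ls m
      ... | false = low-mid (opposite s) l (trans (mid-opposite s) m)

even-or-odd : ∀ m → Even m ⊎ Even (suc m)
even-or-odd zero    = inj₁ (0 , refl)
even-or-odd (suc m) with even-or-odd m
... | inj₁ (h , eq) = inj₂ (suc h , trans (cong (2 +_) eq) (cong suc (sym (+-suc h h))))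
... | inj₂ even     = inj₁ even

¬even∧odd : ∀ m → Even m → Even (suc m) → ⊥
¬even∧odd _ (g , refl) (suc h , eq) = go g h (trans (suc-injective eq) (+-suc h h))
  where
  go : ∀ g h → g + g ≡ suc (h + h) → ⊥
  go (suc g) zero    eq with () ← trans (sym (+-suc g g)) (suc-injective eq)
  go (suc g) (suc h) eq = go g h (suc-injective (trans (sym (+-suc g g)) (trans (suc-injective eq) (cong suc (+-suc h h)))))

even-cancel : ∀ m n → Even (m + (n + n)) → Even m
even-cancel m n even with even-or-odd m
... | inj₁ even-m   = even-m
... | inj₂ (h , eq) = ⊥-elim (¬even∧odd (m + (n + n)) even
        (h + n , trans (cong (_+ (n + n)) eq) (regroup h n)))
  where
  regroup : ∀ h n → h + h + (n + n) ≡ h + n + (h + n)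
  regroup = solve-∀

connection-set : ∀ n q → q < n → Even (n * q) → ConnectionSet n q
connection-set (suc N) q (s≤s q≤N) even with even-or-odd q
... | inj₁ (h , refl) = Palindrome.connection-set h (λ _ → false) (λ _ → refl) q≤N (λ _ _ ())
      (trans (cong (h + h +_) (sum-replicate-zero N)) (+-identityʳ (h + h)))
-- For odd `q = 2h + 1`, evenness of `n q` makes `n` even; the residue `n / 2` is its own negative
-- and supplies the odd element.
... | inj₂ (suc h , eq) with refl ← suc-injective eq with even-cancel (suc N) (suc N * h) (subst Even (expand (suc N) h) even)
  where
  expand : ∀ n h → n * (h + suc h) ≡ n + (n * h + n * h)
  expand = solve-∀
...   | suc g , N≡ with refl ← suc-injective N≡ =
  Palindrome.connection-set h (λ s → does (centre Fin.≟ s)) centre-opposite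
    (≤-trans (+-monoʳ-≤ h (n≤1+n h)) q≤N) low-centre
    (trans (cong (h + h +_) (∑-⟦≟⟧ centre)) (trans (+-comm (h + h) 1) (sym (+-suc h h))))
  where
  g<N : g < g + suc g
  g<N = subst (suc g ≤_) (sym (+-suc g g)) (s≤s (m≤m+n g g))
  -- Here `n = 2 (g + 1)`, and index `g` stands for the residue `g + 1 = n / 2`.
  centre : Fin (g + suc g)
  centre = fromℕ< g<N
  toℕ-centre : toℕ centre ≡ g
  toℕ-centre = Fin.toℕ-fromℕ< g<N
  opposite-centre : opposite centre ≡ centre
  opposite-centre = Fin.toℕ-injective (begin
    toℕ (opposite centre)          ≡⟨ Fin.opposite-prop centre ⟩
    g + suc g ∸ suc (toℕ centre)   ≡⟨ cong (λ c → g + suc g ∸ suc c) toℕ-centre ⟩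
    g + suc g ∸ suc g              ≡⟨ m+n∸n≡m g (suc g) ⟩
    g                              ≡⟨ sym toℕ-centre ⟩
    toℕ centre                     ∎)
    where open ≡-Reasoning
  centre-opposite : ∀ s → does (centre Fin.≟ opposite s) ≡ does (centre Fin.≟ s)
  centre-opposite s with centre Fin.≟ s
  ... | yes refl = dec-true (centre Fin.≟ opposite centre) (sym opposite-centre)
  ... | no  c≢s  = dec-false (centre Fin.≟ opposite s) (λ c≡ →
    c≢s (trans (sym opposite-centre) (trans (cong opposite c≡) (Fin.opposite-involutive s))))
  low-centre : ∀ s → does (toℕ s <? h) ≡ true → does (centre Fin.≟ s) ≡ true → ⊥
  low-centre s l c with refl ← does-sound (centre Fin.≟ s) c =
    <-irrefl refl (<-≤-trans (+-mono-< g<h (s≤s g<h)) q≤N)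
    where
    g<h : g < h
    g<h = subst (_< h) toℕ-centre (does-sound (toℕ centre <? h) l)

n⊖n≡0 : ∀ {n} (i : Fin n) → toℕ (i ⊖ i) ≡ 0
n⊖n≡0 i with ⊖-spec i i
... | inj₁ eq = +-cancelˡ-≡ (toℕ i) _ 0 (trans eq (sym (+-identityʳ (toℕ i))))
... | inj₂ eq = ⊥-elim (too-large {m = 0} (i ⊖ i) (+-cancelˡ-≡ (toℕ i) _ _ (trans eq (lemma _ (toℕ i)))))
  where
  lemma : ∀ n i → n + i ≡ i + (n + 0)
  lemma = solve-∀

record RegularRelation (b q : ℕ) : Set where
  field
    Z        : Fin b → Fin b → Bool
    Z-sym    : ∀ i j → Z i j ≡ Z j i
    Z-irrefl : ∀ i → Z i i ≡ false
    Z-degree : ∀ i → ∑[ j < b ] ⟦ Z i j ⟧ ≡ q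

circulant : ∀ {b q} → ConnectionSet b q → RegularRelation b q
circulant {b} {q} C = record
  { Z        = λ i j → D (j ⊖ i)
  ; Z-sym    = λ i j → [ (λ eq → trans (D-zero (j ⊖ i) (m+n≡0⇒m≡0 _ eq)) (sym (D-zero (i ⊖ j) (m+n≡0⇒n≡0 (toℕ (j ⊖ i)) eq))))
                       , D-sym (j ⊖ i) (i ⊖ j) ]′ (⊖-opposite i j)
  ; Z-irrefl = λ i → D-zero (i ⊖ i) (n⊖n≡0 i)
  ; Z-degree = λ i → trans (∑-⊖ˡ (λ t → ⟦ D t ⟧) i) D-size
  }
  where open ConnectionSet C

-- Blueprints

∑∑-false : ∀ b → ∑[ m < b ] ∑[ i < b ] ⟦ false ⟧ ≡ 0
∑∑-false b = trans (sum-cong-≗ {b} (λ _ → sum-replicate-zero b)) (sum-replicate-zero b)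

-- No pair is spliced; x of e is joined to y of e + 1, …, e + p.  Colouring x for e < p and y for
-- the other pairs cuts the cyclic order.
module ManyPairs {b a p : ℕ} (2p≤1+a : p + p ≤ suc a)
  (Z : Fin b → Fin b → Bool) (Z-sym : ∀ i j → Z i j ≡ Z j i) (Z-irrefl : ∀ i → Z i i ≡ false)
  (Z-degree : ∀ i → suc (∑[ j < b ] ⟦ Z i j ⟧) ≡ p) where

  short : Fin (suc a) → Bool
  short zero    = false
  short (suc t) = does (toℕ t <? p)

  short-sound : ∀ t → short t ≡ true → 0 < toℕ t × toℕ t ≤ p
  short-sound (suc t) eq = s≤s z≤n , does-sound (toℕ t <? p) eq

  short-zero : ∀ t → toℕ t ≡ 0 → short t ≡ false
  short-zero zero _ = refl

  p≤a : p ≤ a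
  p≤a = go p 2p≤1+a
    where
    go : ∀ p → p + p ≤ suc a → p ≤ a
    go zero    _ = z≤n
    go (suc p) h = ≤-trans (s≤s (m≤n+m p p)) (subst (_≤ a) (+-suc p p) (s≤s⁻¹ h))

  -- A step of length at most `p` that wraps around cannot start below `p`, since `2p` is at most
  -- the number of pairs; starting at `p` or above, it ends below `p`, on the other side.
  Y-triangular : ∀ e e′ → does (toℕ e <? p) ≡ does (toℕ e′ <? p) → short (e′ ⊖ e) ≡ true → toℕ e < toℕ e′
  Y-triangular e e′ same Yee′ with ⊖-spec e′ e | short-sound (e′ ⊖ e) Yee′
  ... | inj₁ eq | 0<t , _   = subst (toℕ e <_) eq (m<m+n (toℕ e) 0<t)
  ... | inj₂ eq | _   , t≤p with toℕ e <? p
  ...   | yes e<p = ⊥-elim (<-irrefl eq (<-≤-trans (+-mono-<-≤ e<p t≤p) (≤-trans 2p≤1+a (m≤m+n (suc a) (toℕ e′)))))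
  ...   | no  e≮p = ⊥-elim (<-irrefl eq (+-mono-<-≤ (Fin.toℕ<n e) (≤-trans t≤p p≤e′)))
    where
    p≤e′ : p ≤ toℕ e′
    p≤e′ with toℕ e′ <? p
    ... | no  e′≮p = ≮⇒≥ e′≮p
    ... | yes e′<p = ⊥-elim (true≢false (dec-true (toℕ e′ <? p) e′<p) (trans (sym same) (dec-false (toℕ e <? p) e≮p)))

  blueprint : Blueprint b (suc a) p
  blueprint = record
    { Z = Z ; Z-sym = Z-sym ; Z-irrefl = Z-irrefl ; Z-degree = Z-degree
    ; R            = λ _ _ _ → false
    ; R⊆Z          = λ _ _ _ ()
    ; R-functional = λ _ _ _ _ ()
    ; R-injective  = λ _ _ _ _ ()
    ; R-disjoint   = λ _ _ _ _ ()
    ; Y            = λ e e′ → short (e′ ⊖ e)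
    ; Y-irrefl     = λ e → short-zero (e ⊖ e) (n⊖n≡0 e)
    ; x-degree     = λ e → cong₂ _+_ (∑∑-false b) (trans (∑-⊖ˡ (λ t → ⟦ short t ⟧) e) (∑-< p p≤a))
    ; y-degree     = λ e → cong₂ _+_ (∑∑-false b) (trans (∑-⊖ʳ (λ t → ⟦ short t ⟧) e) (∑-< p p≤a))
    ; side         = λ e → does (toℕ e <? p)
    ; Y-triangular = Y-triangular
    }

-- The first α pairs are joined to the last β pairs.  Each of the latter has a shift δⱼ of its own
-- and is spliced at the columns below p - α; the former use the columns that this leaves free in
-- the first shift, one for each.
module FewPairs {b q α β : ℕ} (C : ConnectionSet b (suc q)) (p≤b : 2 + q ≤ b)
  -- A pair of the first kind gets one splice and `β` edges of `Y`, so as soon as one exists `β` has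
  -- to be `p - 1`.
  (α≤p : α ≤ 2 + q) (β≤q : β ≤ suc q) (α-full : Fin α → β ≡ suc q) where

  open ConnectionSet C
  open RegularRelation (circulant C)

  Kind : Set
  Kind = Fin α ⊎ Fin β

  kind : Fin (α + β) → Kind
  kind = splitAt α

  s : ℕ
  s = 2 + q ∸ α

  s+α≡p : s + α ≡ 2 + q
  s+α≡p = m∸n+n≡m α≤p

  δ-data : Σ (Fin (suc q) → Fin b) λ δ → (∀ j → D (δ j) ≡ true) × (∀ j j′ → δ j ≡ δ j′ → j ≡ j′)
  δ-data = subst (λ c → Σ (Fin c → Fin b) λ δ → (∀ j → D (δ j) ≡ true) × (∀ j j′ → δ j ≡ δ j′ → j ≡ j′)) D-size (enumerate D)

  δ : Fin (suc q) → Fin b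
  δ = proj₁ δ-data

  shift : Kind → Fin b
  shift (inj₁ _) = δ zero
  shift (inj₂ j) = δ (inject≤ j β≤q)

  D-shift : ∀ κ → D (shift κ) ≡ true
  D-shift (inj₁ _) = proj₁ (proj₂ δ-data) zero
  D-shift (inj₂ j) = proj₁ (proj₂ δ-data) (inject≤ j β≤q)

  column<b : ∀ (i : Fin α) → s + toℕ i < b
  column<b i = <-≤-trans (+-monoʳ-< s (Fin.toℕ<n i)) (subst (_≤ b) (sym s+α≡p) p≤b)

  column : Fin α → Fin b
  column i = fromℕ< (column<b i)

  columns : Kind → Fin b → Bool
  columns (inj₁ i) m = does (column i Fin.≟ m)
  columns (inj₂ _) m = does (toℕ m <? s)

  -- Two pairs of the first kind differ in their column, two of the second kind in their shift; the
  -- first kind uses columns from `s` on and the second only those below `s`.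
  columns-disjoint : ∀ κ κ′ m → shift κ ≡ shift κ′ → columns κ m ≡ true → columns κ′ m ≡ true → κ ≡ κ′
  columns-disjoint (inj₁ i) (inj₁ j) m _ ci cj = cong inj₁ (Fin.toℕ-injective (+-cancelˡ-≡ s _ _ (begin
    s + toℕ i       ≡⟨ sym (Fin.toℕ-fromℕ< (column<b i)) ⟩
    toℕ (column i)  ≡⟨ cong toℕ (trans (does-sound (column i Fin.≟ m) ci) (sym (does-sound (column j Fin.≟ m) cj))) ⟩
    toℕ (column j)  ≡⟨ Fin.toℕ-fromℕ< (column<b j) ⟩
    s + toℕ j       ∎)))
    where open ≡-Reasoning
  columns-disjoint (inj₂ i) (inj₂ j) m eq _ _ = cong inj₂ (Fin.inject≤-injective β≤q β≤q i j (proj₂ (proj₂ δ-data) _ _ eq))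
  columns-disjoint (inj₁ i) (inj₂ j) m _ ci cj = ⊥-elim (column≮s i m ci cj)
    where
    column≮s : ∀ i m → does (column i Fin.≟ m) ≡ true → does (toℕ m <? s) ≡ true → ⊥
    column≮s i m ci m<s with refl ← does-sound (column i Fin.≟ m) ci =
      m+n≮m s (toℕ i) (subst (_< s) (Fin.toℕ-fromℕ< (column<b i)) (does-sound (toℕ (column i) <? s) m<s))
  columns-disjoint κ@(inj₂ _) κ′@(inj₁ _) m eq ci cj = sym (columns-disjoint κ′ κ m (sym eq) cj ci)

  size-of : Kind → ℕ
  size-of (inj₁ _) = 1
  size-of (inj₂ _) = s

  ∑-columns : ∀ κ → ∑[ m < b ] ⟦ columns κ m ⟧ ≡ size-of κ
  ∑-columns (inj₁ i) = ∑-⟦≟⟧ (column i)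
  ∑-columns (inj₂ _) = ∑-< s (≤-trans (m∸n≤m (2 + q) α) p≤b)

  -- The splices of a pair lie along one translation, a permutation; this yields `R-functional` and
  -- `R-injective`. The shift belongs to `D`, so they are edges of `Z`.
  R : Fin (α + β) → Fin b → Fin b → Bool
  R e m i = does (shift (kind e) Fin.≟ (i ⊖ m)) ∧ columns (kind e) m

  R-sound : ∀ e m i → R e m i ≡ true → shift (kind e) ≡ i ⊖ m × columns (kind e) m ≡ true
  R-sound e m i eq with shift (kind e) Fin.≟ (i ⊖ m)
  ... | yes sh = sh , eq

  ∑∑R : ∀ e → ∑[ m < b ] ∑[ i < b ] ⟦ R e m i ⟧ ≡ size-of (kind e)
  ∑∑R e = trans (sum-cong-≗ λ m → trans
      (∑-⊖ˡ (λ t → ⟦ does (shift (kind e) Fin.≟ t) ∧ columns (kind e) m ⟧) m) (restrict (columns (kind e) m)))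
    (∑-columns (kind e))
    where
    restrict : ∀ c → ∑[ t < b ] ⟦ does (shift (kind e) Fin.≟ t) ∧ c ⟧ ≡ ⟦ c ⟧
    restrict true  = trans (sum-cong-≗ λ t → cong ⟦_⟧ (Bool.∧-identityʳ (does (shift (kind e) Fin.≟ t)))) (∑-⟦≟⟧ (shift (kind e)))
    restrict false = trans (sum-cong-≗ λ t → cong ⟦_⟧ (Bool.∧-zeroʳ (does (shift (kind e) Fin.≟ t)))) (sum-replicate-zero b)

  left : Kind → Bool
  left (inj₁ _) = true
  left (inj₂ _) = false

  across : Kind → Kind → Bool
  across (inj₁ _) (inj₂ _) = true
  across (inj₂ _) (inj₁ _) = true
  across _        _        = false

  across-sym : ∀ κ κ′ → across κ κ′ ≡ across κ′ κ
  across-sym (inj₁ _) (inj₁ _) = refl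
  across-sym (inj₁ _) (inj₂ _) = refl
  across-sym (inj₂ _) (inj₁ _) = refl
  across-sym (inj₂ _) (inj₂ _) = refl

  across-irrefl : ∀ κ κ′ → left κ ≡ left κ′ → across κ κ′ ≡ false
  across-irrefl (inj₁ _) (inj₁ _) _ = refl
  across-irrefl (inj₂ _) (inj₂ _) _ = refl

  size+across : ∀ κ → size-of κ + ∑[ e < α + β ] ⟦ across κ (kind e) ⟧ ≡ 2 + q
  size+across κ = trans (cong (size-of κ +_) (trans (∑-↑ α (λ e → ⟦ across κ (kind e) ⟧)) (cong₂ _+_
      (sum-cong-≗ λ i → cong (λ κ′ → ⟦ across κ κ′ ⟧) (Fin.splitAt-↑ˡ α i β))
      (sum-cong-≗ λ j → cong (λ κ′ → ⟦ across κ κ′ ⟧) (Fin.splitAt-↑ʳ α β j))))) (go κ)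
    where
    go : ∀ κ → size-of κ + (∑[ i < α ] ⟦ across κ (inj₁ i) ⟧ + ∑[ j < β ] ⟦ across κ (inj₂ j) ⟧) ≡ 2 + q
    go (inj₁ i) = cong suc (trans (cong₂ _+_ (sum-replicate-zero α) (∑-one β)) (α-full i))
    go (inj₂ j) = trans (cong (s +_) (trans (cong₂ _+_ (∑-one α) (sum-replicate-zero β)) (+-identityʳ α))) s+α≡p

  blueprint : Blueprint b (α + β) (2 + q)
  blueprint = record
    { Z = Z ; Z-sym = Z-sym ; Z-irrefl = Z-irrefl ; Z-degree = λ i → cong suc (Z-degree i)
    ; R            = R
    ; R⊆Z          = λ e m i Remi → trans (cong D (sym (proj₁ (R-sound e m i Remi)))) (D-shift (kind e))
    ; R-functional = λ e m i i′ r r′ → ⊖-injectiveˡ m i i′ (trans (sym (proj₁ (R-sound e m i r))) (proj₁ (R-sound e m i′ r′)))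
    ; R-injective  = λ e m m′ i r r′ → ⊖-injectiveʳ i m m′ (trans (sym (proj₁ (R-sound e m i r))) (proj₁ (R-sound e m′ i r′)))
    ; R-disjoint   = λ e e′ m i r r′ → kind-injective (columns-disjoint (kind e) (kind e′) m
                       (trans (proj₁ (R-sound e m i r)) (sym (proj₁ (R-sound e′ m i r′))))
                       (proj₂ (R-sound e m i r)) (proj₂ (R-sound e′ m i r′)))
    ; Y            = λ e e′ → across (kind e) (kind e′)
    ; Y-irrefl     = λ e → across-irrefl (kind e) (kind e) refl
    ; x-degree     = λ e → trans (cong (_+ ∑[ e′ < α + β ] ⟦ across (kind e) (kind e′) ⟧) (∑∑R e)) (size+across (kind e))
    ; y-degree     = λ e → trans (cong₂ _+_ (∑∑R e) (sum-cong-≗ λ e′ → cong ⟦_⟧ (across-sym (kind e′) (kind e)))) (size+across (kind e))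
    ; side         = left ∘ kind
    ; Y-triangular = λ e e′ same Yee′ → ⊥-elim (true≢false Yee′ (across-irrefl (kind e) (kind e′) same))
    }
    where
    kind-injective : ∀ {e e′} → kind e ≡ kind e′ → e ≡ e′
    kind-injective {e} {e′} eq = trans (sym (Fin.join-splitAt α β e)) (trans (cong (join α β) eq) (Fin.join-splitAt α β e′))

-- Up to `p - 1` pairs can all be of the second kind, each with `p` splices. Beyond that
-- `β = p - 1`, and `a < 2p` bounds the remaining `α` by `p`.
few-pairs : ∀ {b q} → ConnectionSet b (suc q) → 2 + q ≤ b → ∀ a → a < (2 + q) + (2 + q) → Blueprint b a (2 + q)
few-pairs {b} {q} C p≤b a a<2p with a ≤? suc q
... | yes a≤q = FewPairs.blueprint {α = 0} C p≤b z≤n a≤q (λ ())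
... | no  a≰q = subst (λ a → Blueprint b a (2 + q)) (m∸n+n≡m (<⇒≤ (≰⇒> a≰q)))
  (FewPairs.blueprint {α = a ∸ suc q} C p≤b
    (subst (a ∸ suc q ≤_) (m+n∸n≡m (2 + q) (suc q)) (∸-monoˡ-≤ (suc q) (s≤s⁻¹ (subst (a <_) (+-suc (2 + q) (suc q)) a<2p))))
    ≤-refl (λ _ → refl))

blueprint-exists : ∀ b a p → p ≤ b → 0 < a → (p ≡ 0 → b ≡ 0) → (p ≡ 1 → 2 ≤ a) →
                   (∀ q → p ≡ suc q → Even (b * q)) → Blueprint b a p
blueprint-exists b (suc a) zero _ _ b≡0 _ _ with refl ← b≡0 refl =
  ManyPairs.blueprint z≤n (λ ()) (λ ()) (λ ()) (λ ())
blueprint-exists b (suc a) (suc q) p≤b _ _ p≡1⇒2≤a even with suc q + suc q ≤? suc a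
... | yes 2p≤a = ManyPairs.blueprint 2p≤a Z Z-sym Z-irrefl (λ i → cong suc (Z-degree i))
  where open RegularRelation (circulant (connection-set b q p≤b (even q refl)))
-- For `p = 1` the relation `Z` is empty and offers nothing to splice; two pairs already satisfy the
-- bound of the other construction.
blueprint-exists b (suc a) (suc zero)    p≤b _ _ p≡1⇒2≤a even | no 2p≰a = ⊥-elim (2p≰a (p≡1⇒2≤a refl))
blueprint-exists b (suc a) (suc (suc q)) p≤b _ _ p≡1⇒2≤a even | no 2p≰a =
  few-pairs (connection-set b (suc q) p≤b (even (suc q) refl)) p≤b (suc a) (≰⇒> 2p≰a)

-- Arithmetic of the parameters

even-*-suc : ∀ n → Even (n * n + n)
even-*-suc zero    = 0 , refl
even-*-suc (suc n) = let h , eq = even-*-suc n in h + suc n , trans (expand n) (trans (cong (_+ (suc n + suc n)) eq) (regroup h (suc n)))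
  where
  expand : ∀ n → suc n * suc n + suc n ≡ n * n + n + (suc n + suc n)
  expand = solve-∀
  regroup : ∀ h m → h + h + (m + m) ≡ h + m + (h + m)
  regroup = solve-∀

-- Since `n r` and `n² + n` are even and `r = n - 3 - q`, the number `n q + 4n` is even; modulo 2 it
-- is `b q`, because `n = 3b + 2a`.
even-b*q : ∀ b a q r → r + (3 + q) ≡ b * 3 + a * 2 → Even ((b * 3 + a * 2) * r) → Even (b * q)
even-b*q b a q r r+d≡n (h , nr≡h+h) = even-cancel (b * q) (b * q + a * q + (n + n)) (subst Even (split b a q)
  (even-cancel (n * q + (n + n + (n + n))) h (subst Even total (even-*-suc n))))
  where
  n = b * 3 + a * 2
  split : ∀ b a q → (b * 3 + a * 2) * q + ((b * 3 + a * 2) + (b * 3 + a * 2) + ((b * 3 + a * 2) + (b * 3 + a * 2)))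
        ≡ b * q + (b * q + a * q + ((b * 3 + a * 2) + (b * 3 + a * 2)) + (b * q + a * q + ((b * 3 + a * 2) + (b * 3 + a * 2))))
  split = solve-∀
  total : n * n + n ≡ n * q + (n + n + (n + n)) + (h + h)
  total = begin
    n * n + n                               ≡⟨ cong (λ m → n * m + n) (sym r+d≡n) ⟩
    n * (r + (3 + q)) + n                   ≡⟨ expand n r q ⟩
    n * q + (n + n + (n + n)) + n * r       ≡⟨ cong (n * q + (n + n + (n + n)) +_) nr≡h+h ⟩
    n * q + (n + n + (n + n)) + (h + h)     ∎
    where
    open ≡-Reasoning
    expand : ∀ n r q → n * (r + (3 + q)) + n ≡ n * q + (n + n + (n + n)) + n * r
    expand = solve-∀

regular⇒≤ : ∀ {n r} (G : Graph n) → Regular r G → Fin n → r ≤ n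
regular⇒≤ {n} {r} G regular v = begin
  r                            ≡⟨ sym (trans (sym (degree≡∑ G v)) (regular v)) ⟩
  ∑[ i < n ] ⟦ adj G v i ⟧     ≤⟨ ∑-mono-≤ (λ i → ⟦⟧≤1 (adj G v i)) ⟩
  ∑[ i < n ] 1                 ≡⟨ ∑-one n ⟩
  n                            ∎
  where open ≤-Reasoning

-- Existence of an optimal graph

Optimal : (n r k : ℕ) → Set
Optimal n r k = Σ (Graph n) λ G → InClass n r k G × DefiningNumber G k (k ∸ 1)

-- One colour is treated apart because `d = 1` does occur there, for a single vertex. The empty
-- partial colouring suffices.
one-colour : ∀ {n r} → Σ (Graph n) (InClass n r 1) → Optimal n r 1
one-colour {n} (G , regular , chromatic@((f , proper) , _)) = G , (regular , chromatic) ,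
  ((λ _ → nothing) , (f , proper , (λ _ _ ()) , λ g _ _ i → Fin1-unique (g i) (f i)) ,
    trans (list-sum≡∑ {n} (λ _ → 0)) (sum-replicate-zero n)) , λ _ _ → z≤n
  where
  Fin1-unique : (i j : Fin 1) → i ≡ j
  Fin1-unique zero zero = refl

-- `b = n - 2k` and `a = k - b = 3k - n`: the first hypothesis becomes `p ≤ b`, the second `0 < a`.
triples-and-pairs : ∀ {k n p} → 2 * k + p ≤ n → n < 3 * k →
  ∃ λ b → ∃ λ a → k ≡ b + a × n ≡ b * 3 + a * 2 × p ≤ b × 0 < a
triples-and-pairs {k} {n} {p} 2k+p≤n n<3k = b , k ∸ b , k≡ , n≡ , p≤b , m<n⇒0<n∸m b<k
  where
  b = n ∸ 2 * k
  n≡2k+b : 2 * k + b ≡ n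
  n≡2k+b = m+[n∸m]≡n (≤-trans (m≤m+n (2 * k) p) 2k+p≤n)
  p≤b : p ≤ b
  p≤b = +-cancelˡ-≤ (2 * k) p b (subst (2 * k + p ≤_) (sym n≡2k+b) 2k+p≤n)
  b<k : b < k
  b<k = +-cancelˡ-< (2 * k) b k (subst₂ _<_ (sym n≡2k+b) (three k) n<3k)
    where
    three : ∀ k → 3 * k ≡ 2 * k + k
    three = solve-∀
  k≡ : k ≡ b + (k ∸ b)
  k≡ = sym (m+[n∸m]≡n (<⇒≤ b<k))
  n≡ : n ≡ b * 3 + (k ∸ b) * 2
  n≡ = trans (sym n≡2k+b) (trans (cong (λ m → 2 * m + b) k≡) (regroup b (k ∸ b)))
    where
    regroup : ∀ b a → 2 * (b + a) + b ≡ b * 3 + a * 2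
    regroup = solve-∀

optimal-exists : ∀ {b a p r} → p ≤ b → 0 < a → r + (2 + p) ≡ b * 3 + a * 2 →
  Σ (Graph (b * 3 + a * 2)) (InClass (b * 3 + a * 2) r (b + a)) → Optimal (b * 3 + a * 2) r (b + a)
optimal-exists {b} {a} {p} {r} p≤b 0<a r+d≡n (G , regular , (f , proper) , _) =
  realise (blueprint-exists b a p p≤b 0<a p≡0⇒b≡0 p≡1⇒2≤a even) (nontrivial p p≤b) r+d≡n
  where
  nontrivial : ∀ p → p ≤ b → 0 < b ⊎ (p ≡ 0 × 0 < a)
  nontrivial zero    _   = inj₂ (refl , 0<a)
  nontrivial (suc p) p≤b = inj₁ (≤-trans (s≤s z≤n) p≤b)
  p≡0⇒b≡0 : p ≡ 0 → b ≡ 0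
  -- With `d = 2` the colour classes have at most two members, so `n ≤ 2k`, while `n = 2k + b`.
  p≡0⇒b≡0 refl = n≤0⇒n≡0 (+-cancelˡ-≤ ((b + a) * 2) b 0
    (subst₂ _≤_ (regroup b a) (sym (+-identityʳ _)) (order-≤ {G = G} regular r+d≡n f proper)))
    where
    regroup : ∀ b a → b * 3 + a * 2 ≡ (b + a) * 2 + b
    regroup = solve-∀
  p≡1⇒2≤a : p ≡ 1 → 2 ≤ a
  p≡1⇒2≤a refl with 2 ≤? a
  ... | yes 2≤a = 2≤a
  -- With `d = 3` and `a = 1` the order is `3k - 1`, exactly one short of `k d`.
  ... | no  2≰a with refl ← ≤-antisym (s≤s⁻¹ (≰⇒> 2≰a)) 0<a =
    ⊥-elim (not-one-deficient-class {G = G} regular r+d≡n f proper (s≤s (s≤s z≤n)) (regroup b))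
    where
    regroup : ∀ b → suc (b * 3 + 1 * 2) ≡ (b + 1) * 3
    regroup = solve-∀
  even : ∀ q → p ≡ suc q → Even (b * q)
  even q refl = even-b*q b a q r r+d≡n (handshake {G = G} regular)

many-colours : ∀ {k n r} → n < 3 * (2 + k) → 2 * (1 + k) ≤ r →
               Σ (Graph n) (InClass n r (2 + k)) → Optimal n r (2 + k)
many-colours {k} {zero} _ _ (G , _ , _ , minimal) = ⊥-elim (minimal 0 (s≤s z≤n) ((λ ()) , (λ ())))
many-colours {k} {n@(suc _)} {r} n<3k 2[k-1]≤r class@(G , regular , (f , proper) , _) = go (n ∸ r) (m+[n∸m]≡n (regular⇒≤ G regular zero))
  where
  go : ∀ d → r + d ≡ n → Optimal n r (2 + k)
  go 0 r+d≡n with () ← subst (n ≤_) (*-zeroʳ k) (order-≤ {G = G} regular r+d≡n f proper)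
  -- With `d = 1` the order is at most the number of colours `2 + k`, but the bound on `r` makes it
  -- at least `2 (1 + k) + 1`.
  go 1 r+d≡n = ⊥-elim (<-irrefl refl (begin-strict
    2 + k            <⟨ s≤s (s≤s (s≤s (m≤m+n k k))) ⟩
    3 + (k + k)      ≡⟨ regroup k ⟩
    2 * (1 + k) + 1  ≤⟨ +-monoˡ-≤ 1 2[k-1]≤r ⟩
    r + 1            ≡⟨ r+d≡n ⟩
    n                ≤⟨ order-≤ {G = G} regular r+d≡n f proper ⟩
    (2 + k) * 1      ≡⟨ *-identityʳ (2 + k) ⟩
    2 + k            ∎))
    where
    open ≤-Reasoning
    regroup : ∀ k → 3 + (k + k) ≡ 2 * (1 + k) + 1
    regroup = solve-∀
  go (suc (suc p)) r+d≡n with triples-and-pairs {2 + k} {n} {p} (begin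
      2 * (2 + k) + p           ≡⟨ regroup k p ⟩
      2 * (1 + k) + (2 + p)     ≤⟨ +-monoˡ-≤ (2 + p) 2[k-1]≤r ⟩
      r + (2 + p)               ≡⟨ r+d≡n ⟩
      n                         ∎) n<3k
    where
    open ≤-Reasoning
    regroup : ∀ k p → 2 * (2 + k) + p ≡ 2 * (1 + k) + (2 + p)
    regroup = solve-∀
  ... | b , a , k≡ , n≡ , p≤b , 0<a = subst₂ (λ n k → Optimal n r k) (sym n≡) (sym k≡)
    (optimal-exists p≤b 0<a (trans r+d≡n n≡) (subst₂ (λ n k → Σ (Graph n) (InClass n r k)) n≡ k≡ class))

theorem1 : (k n r : ℕ) → 1 ≤ k → n < 3 * k → 2 * (k ∸ 1) ≤ r →
    Σ (Graph n) (InClass n r k) →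
    MinDefiningNumber n r k (k ∸ 1)
theorem1 k n r 1≤k n<3k 2[k-1]≤r class = optimal k 1≤k n<3k 2[k-1]≤r class , lower
  where
  optimal : ∀ k → 1 ≤ k → n < 3 * k → 2 * (k ∸ 1) ≤ r → Σ (Graph n) (InClass n r k) → Optimal n r k
  optimal (suc zero)    _ _    _        class = one-colour class
  optimal (suc (suc k)) _ n<3k 2[k-1]≤r class = many-colours n<3k 2[k-1]≤r class
  lower : ∀ G → InClass n r k G → ∀ e → DefiningNumber G k e → k ∸ 1 ≤ e
  lower G (_ , chromatic) e ((p , defining , size≡e) , _) =
    subst (k ∸ 1 ≤_) size≡e (defining-set-size {G = G} chromatic p defining)
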